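{- Let $\alpha$ be a snowy weak composition. Then $$\widehat{\mathfrak{L}}_\alpha=\sum_{D\in\mathsf{LTBPD}(\alpha)}x^{\mathsf{wt}_{\boxdot}(D)}.$$
   Context: A weak composition is a sequence of non-negative integers with finitely many positive entries; $\mathsf{supp}(\alpha)=\{i:\alpha_i>0\}$; partition = weakly decreasing; snowy = positive entries pairwise distinct; $s_i\alpha$ swaps entries $i,i+1$; $x^\beta=\prod x_i^{\beta_i}$. Let $\partial_i(f)=\frac{f-s_if}{x_i-x_{i+1}}$ ($s_i$ swapping $x_i,x_{i+1}$), $\widehat{\pi}_i(f)=x_ix_{i+1}\partial_i(f)$. Top Lascoux polynomials: $\widehat{\mathfrak{L}}_\alpha=x^\alpha$ if $\alpha$ is a partition, $\widehat{\mathfrak{L}}_\alpha=\widehat{\pi}_i(\widehat{\mathfrak{L}}_{s_i\alpha})$ if $\alpha_i<\alpha_{i+1}$. Tiles: blank (no pipe), elbow connecting bottom and right edges, elbow connecting left and top edges, crossing, horizontal segment, vertical segment; rows numbered from the top, columns from the left. Let $n$ be smallest with $\mathsf{supp}(\alpha)\subseteq[n]$ and $m=\max(\alpha)$. A left-to-top BPD of $\alpha$ is an $n\times m$ grid of tiles such that for each $i\in[n]$ with $\alpha_i>0$ a pipe enters from the left in row $i$ and exits at the top of column $\alpha_i$, these are the only pipes, and no two pipes cross more than once; $\mathsf{LTBPD}(\alpha)$ is the set of these. The non-blank weight $\mathsf{wt}_{\boxdot}(D)$ is the weak composition whose $i$-th entry is the number of non-blank tiles in row $i$ of $D$. -}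

module Defs where

open import Data.Nat using (ℕ; zero; suc; _+_; _∸_; _<_; _≤_; _⊔_; pred; _≡ᵇ_)
import Data.Nat as ℕ
open import Data.Integer using (ℤ) renaming (_+_ to _+ℤ_; _-_ to _-ℤ_)
import Data.Integer as ℤ
open import Data.Bool using (Bool; true; false; if_then_else_; _∧_; _∨_)
open import Data.Vec using (Vec; []; _∷_; foldr)
import Data.Vec as Vec
open import Data.Vec.Properties using (≡-dec)
open import Data.List using (List; []; _∷_)
import Data.List as List
open import Data.Product using (Σ; _×_; _,_; proj₁; proj₂)
open import Data.Sum using (_⊎_)
open import Relation.Nullary using (¬_)
open import Relation.Nullary.Decidable using (does)
open import Relation.Binary.PropositionalEquality using (_≡_; _≢_)

-- Weak compositions.  A weak composition is represented by a vector
-- α : Vec ℕ n; entries are indexed 0-based (entry i here = entry i+1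
-- of the paper), and all entries beyond position n are 0.

atD : ∀ {a} {A : Set a} {n} → A → Vec A n → ℕ → A
atD d []       _       = d
atD d (x ∷ xs) zero    = x
atD d (x ∷ xs) (suc i) = atD d xs i

at : ∀ {n} → Vec ℕ n → ℕ → ℕ
at = atD 0

swapV : ∀ {a} {A : Set a} {n} → ℕ → Vec A n → Vec A n
swapV zero    (x ∷ y ∷ xs) = y ∷ x ∷ xs
swapV zero    (x ∷ [])     = x ∷ []
swapV zero    []           = []
swapV (suc i) []           = []
swapV (suc i) (x ∷ xs)     = x ∷ swapV i xs

decAt : ∀ {n} → ℕ → Vec ℕ n → Vec ℕ n
decAt i       []       = []
decAt zero    (x ∷ xs) = pred x ∷ xs
decAt (suc i) (x ∷ xs) = x ∷ decAt i xs

-- n is the smallest integer with supp(α) ⊆ [n]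
Trimmed : ∀ {n} → Vec ℕ n → Set
Trimmed {n} α = (n ≡ 0) ⊎ (0 < at α (pred n))

IsPartition : ∀ {n} → Vec ℕ n → Set
IsPartition α = ∀ i → at α (suc i) ≤ at α i

Snowy : ∀ {n} → Vec ℕ n → Set
Snowy α = ∀ i j → i ≢ j → 0 < at α i → at α i ≢ at α j

maxV : ∀ {n} → Vec ℕ n → ℕ
maxV = foldr _ _⊔_ 0

-- Polynomials in x_1..x_n with integer coefficients, represented by
-- their coefficient function (exponent vector ↦ coefficient); this is
-- the formal power series ring ℤ[[x_1..x_n]] ⊇ ℤ[x_1..x_n], an
-- integral domain, with equality = equality of all coefficients.

Poly : ℕ → Set
Poly n = Vec ℕ n → ℤ

infix 4 _≈P_
_≈P_ : ∀ {n} → Poly n → Poly n → Set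
f ≈P g = ∀ γ → f γ ≡ g γ

zeroP : ∀ {n} → Poly n
zeroP _ = ℤ.0ℤ

_+P_ : ∀ {n} → Poly n → Poly n → Poly n
(f +P g) γ = f γ +ℤ g γ

_-P_ : ∀ {n} → Poly n → Poly n → Poly n
(f -P g) γ = f γ -ℤ g γ

monoP : ∀ {n} → Vec ℕ n → Poly n
monoP β γ = if does (≡-dec ℕ._≟_ γ β) then ℤ.1ℤ else ℤ.0ℤ

swapP : ∀ {n} → ℕ → Poly n → Poly n
swapP i f γ = f (swapV i γ)

mulVar : ∀ {n} → ℕ → Poly n → Poly n
mulVar i f γ with at γ i
... | zero  = ℤ.0ℤ
... | suc _ = f (decAt i γ)

-- h = ∂_i g, i.e. h is the (unique) quotient (g - s_i g)/(x_i - x_{i+1})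
IsDivDiff : ∀ {n} → ℕ → Poly n → Poly n → Set
IsDivDiff i g h = (mulVar i h -P mulVar (suc i) h) ≈P (g -P swapP i g)

sumMonos : ∀ {n} → List (Vec ℕ n) → Poly n
sumMonos = List.foldr (λ β f → monoP β +P f) zeroP

-- Top Lascoux polynomials, via their recursive definition:
-- IsTopLascoux α f  means  f = L̂_α.
-- (L̂_α = x^α if α is a partition; L̂_α = π̂_i L̂_{s_i α} if α_i < α_{i+1},
--  where π̂_i g = x_i x_{i+1} ∂_i g.)

data IsTopLascoux {n : ℕ} : Vec ℕ n → Poly n → Set where
  base : ∀ {α f} → IsPartition α → f ≈P monoP α → IsTopLascoux α f
  step : ∀ {α f} (i : ℕ) (g h : Poly n) →
         at α i < at α (suc i) →
         IsTopLascoux (swapV i α) g →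
         IsDivDiff i g h →
         f ≈P mulVar i (mulVar (suc i) h) →
         IsTopLascoux α f

data Tile : Set where
  blank   : Tile
  elbowBR : Tile
  elbowLT : Tile
  cross   : Tile
  horiz   : Tile
  vert    : Tile

leftE rightE topE botE : Tile → Bool
leftE elbowLT = true
leftE cross   = true
leftE horiz   = true
leftE _       = false
rightE elbowBR = true
rightE cross   = true
rightE horiz   = true
rightE _       = false
topE elbowLT = true
topE cross   = true
topE vert    = true
topE _       = false
botE elbowBR = true
botE cross   = true
botE vert    = true
botE _       = false

isBlank : Tile → Bool
isBlank blank = true
isBlank _     = false

isCross : Tile → Bool
isCross cross = true
isCross _     = false

-- an n × m grid of tiles (rows from the top, columns from the left)
Grid : ℕ → ℕ → Set
Grid n m = Vec (Vec Tile m) n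

tileAt : ∀ {n m} → Grid n m → ℕ → ℕ → Tile
tileAt D r c = atD blank (atD (Vec.replicate _ blank) D r) c

data Dir : Set where
  fromLeft fromBottom : Dir

data Outcome : Set where
  exitTop : ℕ → Outcome   -- leaves the top of the grid at column c (1-based)
  stuck   : Outcome       -- pipe breaks off / leaves the grid elsewhere / out of fuel

trace : ∀ {n m} → Grid n m → ℕ → ℕ → ℕ → Dir → List (ℕ × ℕ) × Outcome
trace D zero r c d = [] , stuck
trace D (suc k) r c d = go (tileAt D r c) d
  where
  up : List (ℕ × ℕ) × Outcome
  up = goUp r
    where
    goUp : ℕ → List (ℕ × ℕ) × Outcome
    goUp zero     = ((zero , c) ∷ []) , exitTop (suc c)
    goUp (suc r') = let p = trace D k r' c fromBottom in ((suc r' , c) ∷ proj₁ p) , proj₂ p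
  right : List (ℕ × ℕ) × Outcome
  right = let p = trace D k r (suc c) fromLeft in ((r , c) ∷ proj₁ p) , proj₂ p
  go : Tile → Dir → List (ℕ × ℕ) × Outcome
  go horiz   fromLeft   = right
  go cross   fromLeft   = right
  go elbowLT fromLeft   = up
  go vert    fromBottom = up
  go cross   fromBottom = up
  go elbowBR fromBottom = right
  go _       _          = [] , stuck

pipe : ∀ {n m} → Grid n m → ℕ → List (ℕ × ℕ) × Outcome
pipe {n} {m} D r = trace D (n + m) r 0 fromLeft

elemB : ℕ × ℕ → List (ℕ × ℕ) → Bool
elemB p []       = false
elemB p (q ∷ qs) = ((proj₁ p ≡ᵇ proj₁ q) ∧ (proj₂ p ≡ᵇ proj₂ q)) ∨ elemB p qs

commonCrossings : ∀ {n m} → Grid n m → List (ℕ × ℕ) → List (ℕ × ℕ) → ℕ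
commonCrossings D []       Q = 0
commonCrossings D (p ∷ P) Q =
  (if isCross (tileAt D (proj₁ p) (proj₂ p)) ∧ elemB p Q then 1 else 0)
  + commonCrossings D P Q

isPos : ℕ → Bool
isPos zero    = false
isPos (suc _) = true

record IsLTBPD {n : ℕ} (α : Vec ℕ n) (D : Grid n (maxV α)) : Set where
  field
    -- tiles fit together: edges of adjacent tiles match; the right and
    -- bottom boundary edges are unused (tileAt is blank outside the grid)
    horizMatch : ∀ r c → r < n → c < maxV α →
                 rightE (tileAt D r c) ≡ leftE (tileAt D r (suc c))
    vertMatch  : ∀ r c → r < n → c < maxV α →
                 botE (tileAt D r c) ≡ topE (tileAt D (suc r) c)
    leftBdry   : ∀ r → r < n → leftE (tileAt D r 0) ≡ isPos (at α r)
    topBdry₁   : ∀ c → c < maxV α → topE (tileAt D 0 c) ≡ true →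
                 Σ ℕ (λ i → at α i ≡ suc c)
    topBdry₂   : ∀ c i → c < maxV α → at α i ≡ suc c → topE (tileAt D 0 c) ≡ true
    pipeExit   : ∀ r → r < n → 0 < at α r → proj₂ (pipe D r) ≡ exitTop (at α r)
    crossOnce  : ∀ r r' → r < n → r' < n → r ≢ r' → 0 < at α r → 0 < at α r' →
                 commonCrossings D (proj₁ (pipe D r)) (proj₁ (pipe D r')) ≤ 1

rowCount : ∀ {m} → Vec Tile m → ℕ
rowCount = foldr _ (λ t k → (if isBlank t then 0 else 1) + k) 0

wtNB : ∀ {n m} → Grid n m → Vec ℕ n
wtNB = Vec.map rowCount

-- Label every pipe by the column through which it leaves and every empty edge by 0.  Reading
-- the grid upwards, one row of tiles moves a label entering from the left through the labels
-- entering from below, and the condition that two pipes cross at most once becomes the local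
-- rule that, at a crossing, the horizontal label is the larger one.  The generating function is
-- therefore a product of row-to-row transfer operators.  Such operators in variables x and y
-- satisfy, for a < b, an exchange relation of Yang-Baxter type,
--   x y (T_x(b) T_y(a) - T_y(b) T_x(a)) = (x - y) T_x(a) T_y(b),
-- which is the recursion defining the top Lascoux polynomials; it is proved column by column.
-- Sorting by ascents leads to a partition, where exactly one pipe dream exists.

module Submission where

open import Defs
open import Data.Nat using (ℕ)
open import Data.Vec using (Vec)
open import Data.List using (List; map)
open import Data.List.Membership.Propositional using (_∈_)
open import Data.List.Relation.Unary.Unique.Propositional using (Unique)
open import Function.Bundles using (_⇔_)

open import Algebra.Bundles using (CommutativeSemiring)
open import Data.Bool using (true; false; if_then_else_; _∧_; T)
open import Data.List using ([]; _∷_; cartesianProductWith)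
open import Data.Maybe using (Maybe; just; nothing; _>>=_)
import Data.Maybe as Maybe
open import Data.Nat using (zero; suc; z≤n; s≤s; s≤s⁻¹; z<s; _≡ᵇ_; _<ᵇ_)
open import Data.Product using (∃; _×_; _,_; proj₁; proj₂)
open import Data.Sum using (_⊎_; inj₁; inj₂)
open import Data.Vec using ([]; _∷_; replicate)
open import Function using (_∘_)
open import Level using (Level; 0ℓ)
open import Relation.Nullary using (¬_; Dec; yes; no; contradiction)

-- A pipe dream is defined globally, through traced pipes, while the generating function has to be
-- cut into rows. The bridge is a conserved quantity: for two labels, the number of inversions,
-- corrected by crossings, is the same before and after each row. Since labels increase along the
-- top border, a crossing in the wrong order must be undone by a second one; conversely, a snowy
-- composition leaves room for at most one crossing in the right order. The exchange relation alone
-- is not inductive: after one column the carried labels may be equal or in the other order. It is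
-- therefore proved simultaneously with the invariance of T_x(a) T_y(b) under exchanging x and y for
-- a ≤ b. Both are stated over an arbitrary commutative semiring and later applied to expressions
-- that act on power series as multiplication operators. The recursion also demands an explicit
-- quotient by x - y. It is found by dividing the generating function by x y, which the exchange
-- relation itself shows to be possible.

module Labelling where

  open import Data.Nat using (_+_; _*_; _≤_; _<_)
  open import Data.Nat.Properties
  open import Data.Nat.Solver using (module +-*-Solver)
  open import Data.Unit using (⊤)
  open import Relation.Binary.PropositionalEquality

  -- Multiplicities and inversions of labels.

  ι : ℕ → ℕ → ℕ
  ι p h = if p ≡ᵇ h then 1 else 0

  occurrences : ∀ {m} → ℕ → Vec ℕ m → ℕ
  occurrences a []       = 0
  occurrences a (v ∷ vs) = ι a v + occurrences a vs

  inversions : ∀ {m} → ℕ → ℕ → Vec ℕ m → ℕ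
  inversions b a []       = 0
  inversions b a (v ∷ vs) = ι b v * occurrences a vs + inversions b a vs

  ι-refl : ∀ p → ι p p ≡ 1
  ι-refl zero    = refl
  ι-refl (suc p) = ι-refl p

  ι-≢ : ∀ {p h} → p ≢ h → ι p h ≡ 0
  ι-≢ {zero}  {zero}  ne = contradiction refl ne
  ι-≢ {zero}  {suc h} ne = refl
  ι-≢ {suc p} {zero}  ne = refl
  ι-≢ {suc p} {suc h} ne = ι-≢ (ne ∘ cong suc)

  occurrences-≢ : ∀ {m} a (vs : Vec ℕ m) → (∀ i → i < m → at vs i ≢ a) → occurrences a vs ≡ 0
  occurrences-≢ a []       ne = refl
  occurrences-≢ a (v ∷ vs) ne =
    cong₂ _+_ (ι-≢ (ne 0 z<s ∘ sym)) (occurrences-≢ a vs (λ i lt → ne (suc i) (s≤s lt)))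

  occurrences-at : ∀ {m a} (vs : Vec ℕ m) i → at vs i ≡ suc a → 0 < occurrences (suc a) vs
  occurrences-at {a = a} (v ∷ vs) zero refl rewrite ι-refl a = z<s
  occurrences-at (v ∷ vs) (suc i) e    = <-≤-trans (occurrences-at vs i e) (m≤n+m _ _)

  occurrences-find : ∀ {m a} (vs : Vec ℕ m) → 0 < occurrences a vs → ∃ λ i → at vs i ≡ a
  occurrences-find {a = a} (v ∷ vs) lt with a ≟ v
  ... | yes e = 0 , sym e
  ... | no ne rewrite ι-≢ ne with occurrences-find vs lt
  ...   | i , e = suc i , e

  at-replicate : ∀ m c → at (replicate m 0) c ≡ 0
  at-replicate zero    c       = refl
  at-replicate (suc m) zero    = refl
  at-replicate (suc m) (suc c) = at-replicate m c

  at-≥ : ∀ {m} (vs : Vec ℕ m) {c} → m ≤ c → at vs c ≡ 0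
  at-≥ []       le = refl
  at-≥ (v ∷ vs) (s≤s le) = at-≥ vs le

  at-<⇒< : ∀ {m} (vs : Vec ℕ m) {c} → 0 < at vs c → c < m
  at-<⇒< {m} vs {c} lt with <-≤-connex c m
  ... | inj₁ c<m = c<m
  ... | inj₂ m≤c = contradiction (subst (0 <_) (at-≥ vs m≤c) lt) (λ ())

  snowy-tail : ∀ {n} {a} {α : Vec ℕ n} → Snowy (a ∷ α) → Snowy α
  snowy-tail s i j ne lt = s (suc i) (suc j) (ne ∘ suc-injective) lt

  occurrences-snowy : ∀ {n} a (α : Vec ℕ n) → Snowy α → occurrences (suc a) α ≤ 1
  occurrences-snowy a []      s = z≤n
  occurrences-snowy a (x ∷ α) s with suc a ≟ x
  ... | no ne rewrite ι-≢ ne = occurrences-snowy a α (snowy-tail s)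
  ... | yes refl rewrite ι-refl a
               | occurrences-≢ (suc a) α (λ i _ e → s 0 (suc i) (λ ()) z<s (sym e)) = ≤-refl

  -- Every counted pair consists of a position of `b` and a position of `a`.
  inversions-≤ : ∀ {m} b a (vs : Vec ℕ m) → inversions b a vs ≤ occurrences b vs * occurrences a vs
  inversions-≤ b a []       = z≤n
  inversions-≤ b a (v ∷ vs) = begin
    ι b v * occurrences a vs + inversions b a vs                 ≤⟨ +-monoʳ-≤ _ (inversions-≤ b a vs) ⟩
    ι b v * occurrences a vs + occurrences b vs * occurrences a vs        ≡⟨ *-distribʳ-+ (occurrences a vs) (ι b v) (occurrences b vs) ⟨
    (ι b v + occurrences b vs) * occurrences a vs                 ≤⟨ *-monoʳ-≤ (ι b v + occurrences b vs) (m≤n+m (occurrences a vs) (ι a v)) ⟩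
    (ι b v + occurrences b vs) * (ι a v + occurrences a vs)       ∎
    where open ≤-Reasoning

  inversions-snowy : ∀ {n} b a (α : Vec ℕ n) → Snowy α → inversions (suc b) (suc a) α ≤ 1
  inversions-snowy b a α s = ≤-trans (inversions-≤ _ _ α) (*-mono-≤ (occurrences-snowy b α s) (occurrences-snowy a α s))

  vec-ext : ∀ {m} (us vs : Vec ℕ m) → (∀ c → c < m → at us c ≡ at vs c) → us ≡ vs
  vec-ext []       []       e = refl
  vec-ext (u ∷ us) (v ∷ vs) e = cong₂ _∷_ (e 0 z<s) (vec-ext us vs (λ c lt → e (suc c) (s≤s lt)))

  -- The columns j + 1, …, j + m, as labelled on the top edge of a pipe dream of α.
  topLabels : ∀ {n} → ℕ → (m : ℕ) → Vec ℕ n → Vec ℕ m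
  topLabels j zero    α = []
  topLabels j (suc m) α = (if isPos (occurrences (suc j) α) then suc j else 0) ∷ topLabels (suc j) m α

  topLabels-present : ∀ {n m} j (α : Vec ℕ n) c i → c < m → at α i ≡ suc (j + c) → at (topLabels j m α) c ≡ suc (j + c)
  topLabels-present {m = suc m} j α zero i lt e rewrite +-identityʳ j with occurrences (suc j) α | occurrences-at α i e
  ... | suc _ | _ = refl
  topLabels-present {m = suc m} j α (suc c) i (s≤s lt) e rewrite +-suc j c = topLabels-present (suc j) α c i lt e

  topLabels-pos : ∀ {n m} j (α : Vec ℕ n) c → 0 < at (topLabels j m α) c →
            at (topLabels j m α) c ≡ suc (j + c) × ∃ λ i → at α i ≡ suc (j + c)
  topLabels-pos {m = suc m} j α zero lt rewrite +-identityʳ j with occurrences (suc j) α in e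
  ... | suc k = refl , occurrences-find α (subst (0 <_) (sym e) z<s)
  topLabels-pos {m = suc m} j α (suc c) lt rewrite +-suc j c = topLabels-pos {m = m} (suc j) α c lt

  occurrences-topLabels : ∀ {n} m j a (α : Vec ℕ n) → suc a ≤ j → occurrences (suc a) (topLabels j m α) ≡ 0
  occurrences-topLabels zero    j a α le = refl
  occurrences-topLabels (suc m) j a α le with occurrences (suc j) α
  ... | zero  = occurrences-topLabels m (suc j) a α (m≤n⇒m≤1+n le)
  ... | suc _ rewrite ι-≢ (<⇒≢ le) = occurrences-topLabels m (suc j) a α (m≤n⇒m≤1+n le)

  -- A nonzero label sits in the column of the same number, so the larger of two labels never
  -- precedes the smaller.
  inversions-topLabels : ∀ {n} m j b a (α : Vec ℕ n) → a < b → inversions (suc b) (suc a) (topLabels j m α) ≡ 0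
  inversions-topLabels zero    j b a α lt = refl
  inversions-topLabels (suc m) j b a α lt with occurrences (suc j) α
  ... | zero  = inversions-topLabels m (suc j) b a α lt
  ... | suc _ with b ≟ j
  ...   | no ne rewrite ι-≢ ne = inversions-topLabels m (suc j) b a α lt
  ...   | yes refl rewrite occurrences-topLabels m (suc j) a α (s≤s (<⇒≤ lt)) | *-zeroʳ (ι b b) = inversions-topLabels m (suc j) b a α lt

  -- Labellings of the edges of a grid.

  -- Arguments: left label, tile, bottom label, right label, top label.  The relation P
  -- constrains the vertical and horizontal labels at a crossing.
  data Local (P : ℕ → ℕ → Set) : ℕ → Tile → ℕ → ℕ → ℕ → Set where
    blank : Local P 0 blank 0 0 0
    vert  : ∀ {v} → Local P 0 vert (suc v) 0 (suc v)
    bend  : ∀ {v} → Local P 0 elbowBR (suc v) (suc v) 0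
    horiz : ∀ {h} → Local P (suc h) horiz 0 (suc h) 0
    rise  : ∀ {h} → Local P (suc h) elbowLT 0 0 (suc h)
    cross : ∀ {h v} → P (suc v) (suc h) → Local P (suc h) cross (suc v) (suc h) (suc v)

  data Row (P : ℕ → ℕ → Set) : ℕ → ∀ {m} → Vec Tile m → Vec ℕ m → Vec ℕ m → Set where
    []  : Row P 0 [] [] []
    _∷_ : ∀ {h t v h′ w m} {ts : Vec Tile m} {vs ws} →
          Local P h t v h′ w → Row P h′ ts vs ws → Row P h (t ∷ ts) (v ∷ vs) (w ∷ ws)

  data Lab (P : ℕ → ℕ → Set) {m} : ∀ {n} → Vec ℕ n → Grid n m → Vec ℕ m → Set where
    []  : Lab P [] [] (replicate m 0)
    _∷_ : ∀ {a ts vs ws n} {α : Vec ℕ n} {D} →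
          Row P a ts vs ws → Lab P α D vs → Lab P (a ∷ α) (ts ∷ D) ws

  private variable
    P : ℕ → ℕ → Set
    n m : ℕ

  Hrow : ∀ {h} {ts : Vec Tile m} {vs ws} → Row P h ts vs ws → ℕ → ℕ
  Hrow {h = h} R       zero    = h
  Hrow         []      (suc c) = 0
  Hrow         (_ ∷ R) (suc c) = Hrow R c

  -- `H G r c` belongs to the left edge of the cell and `V G r c` to its top edge; hence
  -- `V G (suc r) c` is the bottom label, and column `m` and row `n` give the right and bottom
  -- borders.
  H V : ∀ {α : Vec ℕ n} {D : Grid n m} {ws} → Lab P α D ws → ℕ → ℕ → ℕ
  H []      _       c = 0
  H (R ∷ G) zero    c = Hrow R c
  H (R ∷ G) (suc r) c = H G r c
  V {ws = ws} G   zero    c = at ws c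
  V [] (suc r) c = 0
  V (R ∷ G)       (suc r) c = V G r c

  local-row : ∀ {h} {ts : Vec Tile m} {vs ws} (R : Row P h ts vs ws) c → c < m →
              Local P (Hrow R c) (atD blank ts c) (at vs c) (Hrow R (suc c)) (at ws c)
  local-row (l ∷ R) zero    lt       = l
  local-row (l ∷ R) (suc c) (s≤s lt) = local-row R c lt

  local : ∀ {α : Vec ℕ n} {D : Grid n m} {ws} (G : Lab P α D ws) r c → r < n → c < m →
          Local P (H G r c) (tileAt D r c) (V G (suc r) c) (H G r (suc c)) (V G r c)
  local (R ∷ G) zero    c _         c<m = local-row R c c<m
  local (R ∷ G) (suc r) c (s≤s r<n) c<m = local G r c r<n c<m

  H-left : ∀ {α : Vec ℕ n} {D : Grid n m} {ws} (G : Lab P α D ws) r → H G r 0 ≡ at α r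
  H-left []      r       = refl
  H-left (R ∷ G) zero    = refl
  H-left (R ∷ G) (suc r) = H-left G r

  Hrow-right : ∀ {h} {ts : Vec Tile m} {vs ws} (R : Row P h ts vs ws) → Hrow R m ≡ 0
  Hrow-right []      = refl
  Hrow-right (_ ∷ R) = Hrow-right R

  H-right : ∀ {α : Vec ℕ n} {D : Grid n m} {ws} (G : Lab P α D ws) r → H G r m ≡ 0
  H-right []      r       = refl
  H-right (R ∷ G) zero    = Hrow-right R
  H-right (R ∷ G) (suc r) = H-right G r

  V-bottom : ∀ {α : Vec ℕ n} {D : Grid n m} {ws} (G : Lab P α D ws) c → V G n c ≡ 0
  V-bottom {m = m} [] c = at-replicate m c
  V-bottom (R ∷ G) c = V-bottom G c

  atD-≥ : ∀ {A : Set} {d : A} {m} (ts : Vec A m) {c} → m ≤ c → atD d ts c ≡ d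
  atD-≥ []       le = refl
  atD-≥ (t ∷ ts) (s≤s le) = atD-≥ ts le

  atD-replicate : ∀ {A : Set} {d : A} m c → atD d (replicate m d) c ≡ d
  atD-replicate zero    c       = refl
  atD-replicate (suc m) zero    = refl
  atD-replicate (suc m) (suc c) = atD-replicate m c

  tileAt-below : ∀ (D : Grid n m) {r} c → n ≤ r → tileAt D r c ≡ blank
  tileAt-below {m = m} D c le rewrite atD-≥ {d = replicate m blank} D le = atD-replicate m c

  -- Conservation of labels and of corrected inversions.

  χ : ℕ → ℕ → ℕ → Tile → ℕ → ℕ
  χ p q h t v = if isCross t then ι p h * ι q v else 0

  rowCrossings : ∀ {h} {ts : Vec Tile m} {vs ws} → ℕ → ℕ → Row P h ts vs ws → ℕ
  rowCrossings p q [] = 0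
  rowCrossings p q (_∷_ {h} {t} {v} l R) = χ p q h t v + rowCrossings p q R

  -- At a counted crossing the first label is horizontal and the second vertical, so the two orders
  -- of the arguments count different crossings.
  crossings : ∀ {α : Vec ℕ n} {D : Grid n m} {ws} → ℕ → ℕ → Lab P α D ws → ℕ
  crossings p q []      = 0
  crossings p q (R ∷ G) = rowCrossings p q R + crossings p q G

  -- No tile creates, destroys or merges nonzero labels, and nothing leaves a `Row` on the right.
  occurrences-row : ∀ {h} {ts : Vec Tile m} {vs ws} a → Row P h ts vs ws → occurrences (suc a) (h ∷ vs) ≡ occurrences (suc a) ws
  occurrences-row a [] = refl
  occurrences-row a (blank ∷ R) = occurrences-row a R
  occurrences-row a (vert ∷ R) = cong (ι a _ +_) (occurrences-row a R)
  occurrences-row a (bend ∷ R) = occurrences-row a R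
  occurrences-row a (horiz ∷ R) = occurrences-row a R
  occurrences-row a (rise ∷ R) = cong (ι a _ +_) (occurrences-row a R)
  occurrences-row a (cross {h} {v} _ ∷ R) =
    trans (solve 3 (λ x y z → x :+ (y :+ z) := y :+ (x :+ z)) refl (ι a h) (ι a v) _)
          (cong (ι a v +_) (occurrences-row a R))
    where open +-*-Solver

  -- In the word formed by the label travelling to the right followed by the labels of the
  -- remaining columns, a crossing interchanges two adjacent letters; no other tile changes
  -- the order of the letters.
  inversions-local : ∀ {h t v h′ w} b a (vs : Vec ℕ m) → Local P h t v h′ w → let b′ = suc b ; a′ = suc a in
              inversions b′ a′ (h ∷ v ∷ vs) + χ a′ b′ h t v ≡ inversions b′ a′ (w ∷ h′ ∷ vs) + χ b′ a′ h t v
  inversions-local b a vs blank = refl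
  inversions-local b a vs vert = refl
  inversions-local b a vs bend = refl
  inversions-local b a vs horiz = refl
  inversions-local b a vs rise = refl
  inversions-local b a vs (cross {h} {v} _) =
    solve 6 (λ bh bv ah av c i →
               (bh :* (av :+ c) :+ (bv :* c :+ i)) :+ ah :* bv :=
               (bv :* (ah :+ c) :+ (bh :* c :+ i)) :+ bh :* av) refl
      (ι b h) (ι b v) (ι a h) (ι a v) (occurrences (suc a) vs) (inversions (suc b) (suc a) vs)
    where open +-*-Solver

  -- The first column changes the word as in `inversions-local`; the letters behind its top label
  -- then turn into the top labels of the other columns, which contain `a` equally often by
  -- `occurrences-row`.
  inversions-row : ∀ {h} {ts : Vec Tile m} {vs ws} b a (R : Row P h ts vs ws) → let b′ = suc b ; a′ = suc a in
            inversions b′ a′ (h ∷ vs) + rowCrossings a′ b′ R ≡ inversions b′ a′ ws + rowCrossings b′ a′ R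
  inversions-row b a [] = refl
  inversions-row b a (_∷_ {h} {t} {v} {h′} {w} {vs = vs} {ws} l R) = begin
    inversions b′ a′ (h ∷ v ∷ vs) + (χ a′ b′ h t v + x)        ≡⟨ +-assoc (inversions b′ a′ (h ∷ v ∷ vs)) (χ a′ b′ h t v) x ⟨
    inversions b′ a′ (h ∷ v ∷ vs) + χ a′ b′ h t v + x          ≡⟨ cong (_+ x) (inversions-local b a vs l) ⟩
    ι b′ w * occurrences a′ (h′ ∷ vs) + inversions b′ a′ (h′ ∷ vs) + z + x
      ≡⟨ solve 4 (λ i j z x → i :+ j :+ z :+ x := i :+ (j :+ x) :+ z) refl (ι b′ w * occurrences a′ (h′ ∷ vs)) (inversions b′ a′ (h′ ∷ vs)) z x ⟩
    ι b′ w * occurrences a′ (h′ ∷ vs) + (inversions b′ a′ (h′ ∷ vs) + x) + z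
      ≡⟨ cong₂ (λ i j → ι b′ w * i + j + z) (occurrences-row a R) (inversions-row b a R) ⟩
    ι b′ w * occurrences a′ ws + (inversions b′ a′ ws + y) + z
      ≡⟨ solve 4 (λ i j y z → i :+ (j :+ y) :+ z := i :+ j :+ (z :+ y)) refl (ι b′ w * occurrences a′ ws) (inversions b′ a′ ws) y z ⟩
    inversions b′ a′ (w ∷ ws) + (z + y) ∎
    where
    open ≡-Reasoning
    open +-*-Solver
    b′ = suc b
    a′ = suc a
    x = rowCrossings a′ b′ R
    y = rowCrossings b′ a′ R
    z = χ b′ a′ h t v

  occurrences-lab : ∀ {α : Vec ℕ n} {D : Grid n m} {ws} a → Lab P α D ws → occurrences (suc a) α ≡ occurrences (suc a) ws
  occurrences-lab {m = m} a [] = sym (occurrences-≢ (suc a) (replicate m 0) (λ i _ e → 0≢1+n (trans (sym (at-replicate m i)) e)))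
  occurrences-lab {α = x ∷ α} a (R ∷ G) = trans (cong (ι (suc a) x +_) (occurrences-lab a G)) (occurrences-row a R)

  inversions-replicate : ∀ b a m → inversions (suc b) a (replicate m 0) ≡ 0
  inversions-replicate b a zero    = refl
  inversions-replicate b a (suc m) = inversions-replicate b a m

  -- The row identities add up from the bottom. Replacing the tail of the word by the labels above
  -- it preserves the number of letters `a` behind the entry `h`, by `occurrences-lab`.
  inversions-lab : ∀ {α : Vec ℕ n} {D : Grid n m} {ws} b a (G : Lab P α D ws) → let b′ = suc b ; a′ = suc a in
            inversions b′ a′ α + crossings a′ b′ G ≡ inversions b′ a′ ws + crossings b′ a′ G
  inversions-lab {m = m} b a [] = cong (_+ 0) (sym (inversions-replicate b (suc a) m))
  inversions-lab {ws = ws} b a (_∷_ {a = h} {vs = vs} {α = α} R G) = begin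
    ι b′ h * occurrences a′ α + inversions b′ a′ α + (x + x′)
      ≡⟨ solve 4 (λ i j x y → i :+ j :+ (x :+ y) := i :+ (j :+ y) :+ x) refl (ι b′ h * occurrences a′ α) (inversions b′ a′ α) x x′ ⟩
    ι b′ h * occurrences a′ α + (inversions b′ a′ α + x′) + x
      ≡⟨ cong₂ (λ i j → ι b′ h * i + j + x) (occurrences-lab a G) (inversions-lab b a G) ⟩
    ι b′ h * occurrences a′ vs + (inversions b′ a′ vs + y′) + x
      ≡⟨ solve 4 (λ i j x y → i :+ (j :+ y) :+ x := i :+ j :+ x :+ y) refl (ι b′ h * occurrences a′ vs) (inversions b′ a′ vs) x y′ ⟩
    inversions b′ a′ (h ∷ vs) + x + y′ ≡⟨ cong (_+ y′) (inversions-row b a R) ⟩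
    inversions b′ a′ ws + y + y′       ≡⟨ +-assoc (inversions b′ a′ ws) y y′ ⟩
    inversions b′ a′ ws + (y + y′)     ∎
    where
    open ≡-Reasoning
    open +-*-Solver
    b′ = suc b
    a′ = suc a
    x = rowCrossings a′ b′ R
    x′ = crossings a′ b′ G
    y = rowCrossings b′ a′ R
    y′ = crossings b′ a′ G

  -- Locating the crossings of two given labels.

  record Crossing {α : Vec ℕ n} {D : Grid n m} {ws} (G : Lab P α D ws) (p q r c : ℕ) : Set where
    constructor crossing
    field
      r<n     : r < n
      c<m     : c < m
      isCr    : tileAt D r c ≡ cross
      H≡      : H G r c ≡ p
      V≡      : V G (suc r) c ≡ q

  χ-cross : ∀ p q → χ p q p cross q ≡ 1
  χ-cross p q rewrite ι-refl p | ι-refl q = refl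

  χ-find : ∀ p q {h t v} → 0 < χ p q h t v → t ≡ cross × h ≡ p × v ≡ q
  χ-find p q {h} {cross} {v} lt with p ≟ h | q ≟ v
  ... | yes e | yes e′ = refl , sym e , sym e′
  ... | no ne | _      = contradiction (subst (λ k → 0 < k * ι q v) (ι-≢ ne) lt) (λ ())
  ... | yes _ | no ne  = contradiction (subst (0 <_) (trans (cong (ι p h *_) (ι-≢ ne)) (*-zeroʳ (ι p h))) lt) (λ ())

  rowCrossings-cross : ∀ {h} {ts : Vec Tile m} {vs ws} p q (R : Row P h ts vs ws) c →
               atD blank ts c ≡ cross → Hrow R c ≡ p → at vs c ≡ q → 0 < rowCrossings p q R
  rowCrossings-cross p q (l ∷ R) zero refl refl refl rewrite χ-cross p q = z<s
  rowCrossings-cross p q (l ∷ R) (suc c) e f g = <-≤-trans (rowCrossings-cross p q R c e f g) (m≤n+m _ _)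

  rowCrossings-find : ∀ {h} {ts : Vec Tile m} {vs ws} p q (R : Row P h ts vs ws) → 0 < rowCrossings p q R →
              ∃ λ c → c < m × atD blank ts c ≡ cross × Hrow R c ≡ p × at vs c ≡ q
  rowCrossings-find p q (_∷_ {h} {t} {v} l R) lt with χ p q h t v in e
  ... | suc k with χ-find p q {h} {t} {v} (subst (0 <_) (sym e) z<s)
  ...   | a , b , d = 0 , z<s , a , b , d
  rowCrossings-find p q (_∷_ {h} {t} {v} l R) lt | zero with rowCrossings-find p q R lt
  ... | c , c<m , es = suc c , s≤s c<m , es

  rowCrossings-unique : ∀ {h} {ts : Vec Tile m} {vs ws} p q (R : Row P h ts vs ws) → rowCrossings p q R ≤ 1 → ∀ c d →
                atD blank ts c ≡ cross → Hrow R c ≡ p → at vs c ≡ q →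
                atD blank ts d ≡ cross → Hrow R d ≡ p → at vs d ≡ q → c ≡ d
  rowCrossings-unique p q (l ∷ R) le zero zero _ _ _ _ _ _ = refl
  rowCrossings-unique p q (l ∷ R) le zero (suc d) refl refl refl e f g rewrite χ-cross p q =
    contradiction (≤-trans (rowCrossings-cross p q R d e f g) (s≤s⁻¹ le)) (λ ())
  rowCrossings-unique p q (l ∷ R) le (suc c) zero e f g refl refl refl rewrite χ-cross p q =
    contradiction (≤-trans (rowCrossings-cross p q R c e f g) (s≤s⁻¹ le)) (λ ())
  rowCrossings-unique p q (l ∷ R) le (suc c) (suc d) e f g e′ f′ g′ =
    cong suc (rowCrossings-unique p q R (≤-trans (m≤n+m _ _) le) c d e f g e′ f′ g′)

  crossings-cross : ∀ {α : Vec ℕ n} {D : Grid n m} {ws} (G : Lab P α D ws) {p q r c} → Crossing G p q r c → 0 < crossings p q G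
  crossings-cross (R ∷ G) {r = zero}  {c} (crossing _ _ t h v) = ≤-trans (rowCrossings-cross _ _ R c t h v) (m≤m+n _ _)
  crossings-cross (R ∷ G) {r = suc r} (crossing (s≤s r<n) c<m t h v) =
    ≤-trans (crossings-cross G (crossing r<n c<m t h v)) (m≤n+m _ _)

  crossings-find : ∀ {α : Vec ℕ n} {D : Grid n m} {ws} (G : Lab P α D ws) {p q} → 0 < crossings p q G →
           ∃ λ r → ∃ λ c → Crossing G p q r c
  crossings-find (R ∷ G) {p} {q} lt with rowCrossings p q R in e
  ... | suc k with rowCrossings-find p q R (subst (0 <_) (sym e) z<s)
  ...   | c , c<m , t , h , v = 0 , c , crossing z<s c<m t h v
  crossings-find (R ∷ G) {p} {q} lt | zero with crossings-find G lt
  ... | r , c , crossing r<n c<m t h v = suc r , c , crossing (s≤s r<n) c<m t h v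

  -- Two different cells would contribute at least 2 to the count.
  crossings-unique : ∀ {α : Vec ℕ n} {D : Grid n m} {ws} (G : Lab P α D ws) {p q r c r′ c′} → crossings p q G ≤ 1 →
             Crossing G p q r c → Crossing G p q r′ c′ → r ≡ r′ × c ≡ c′
  crossings-unique (R ∷ G) {r = zero} {r′ = zero} le (crossing _ _ t h v) (crossing _ _ t′ h′ v′) =
    refl , rowCrossings-unique _ _ R (≤-trans (m≤m+n _ _) le) _ _ t h v t′ h′ v′
  crossings-unique (R ∷ G) {r = zero} {r′ = suc _} le (crossing _ _ t h v) (crossing (s≤s a) b t′ h′ v′) =
    contradiction (≤-trans (+-mono-≤ (rowCrossings-cross _ _ R _ t h v) (crossings-cross G (crossing a b t′ h′ v′))) le) λ { (s≤s ()) }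
  crossings-unique (R ∷ G) {r = suc _} {r′ = zero} le (crossing (s≤s a) b t′ h′ v′) (crossing _ _ t h v) =
    contradiction (≤-trans (+-mono-≤ (rowCrossings-cross _ _ R _ t h v) (crossings-cross G (crossing a b t′ h′ v′))) le) λ { (s≤s ()) }
  crossings-unique (R ∷ G) {r = suc _} {r′ = suc _} le (crossing (s≤s a) b t h v) (crossing (s≤s a′) b′ t′ h′ v′)
    with crossings-unique G (≤-trans (m≤n+m _ _) le) (crossing a b t h v) (crossing a′ b′ t′ h′ v′)
  ... | refl , e = refl , e

  cross-holds : ∀ {h t v h′ w} → Local P h t v h′ w → t ≡ cross → P v h
  cross-holds (cross p) _ = p

  -- Without such crossings, inversions-lab bounds the number of crossings of a and b by the
  -- number of inversions of α, which is at most 1 for snowy α.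
  crossings-bad : ∀ {α : Vec ℕ n} {D : Grid n m} {ws} (G : Lab _<_ α D ws) {p q} → p < q → crossings p q G ≡ 0
  crossings-bad G {p} {q} p<q with crossings p q G in e
  ... | zero  = refl
  ... | suc k with crossings-find G {p} {q} (subst (0 <_) (sym e) z<s)
  ...   | r , c , crossing r<n c<m t h v =
          contradiction (subst₂ _<_ v h (cross-holds (local G r c r<n c<m) t)) (<⇒≯ p<q)

  -- Labellings and the matching of tile edges.

  leftE-local : ∀ {h t v h′ w} → Local P h t v h′ w → leftE t ≡ isPos h
  leftE-local blank = refl
  leftE-local vert = refl
  leftE-local bend = refl
  leftE-local horiz = refl
  leftE-local rise = refl
  leftE-local (cross _) = refl

  botE-local : ∀ {h t v h′ w} → Local P h t v h′ w → botE t ≡ isPos v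
  botE-local blank = refl
  botE-local vert = refl
  botE-local bend = refl
  botE-local horiz = refl
  botE-local rise = refl
  botE-local (cross _) = refl

  rightE-local : ∀ {h t v h′ w} → Local P h t v h′ w → rightE t ≡ isPos h′
  rightE-local blank = refl
  rightE-local vert = refl
  rightE-local bend = refl
  rightE-local horiz = refl
  rightE-local rise = refl
  rightE-local (cross _) = refl

  topE-local : ∀ {h t v h′ w} → Local P h t v h′ w → topE t ≡ isPos w
  topE-local blank = refl
  topE-local vert = refl
  topE-local bend = refl
  topE-local horiz = refl
  topE-local rise = refl
  topE-local (cross _) = refl

  local-exists : ∀ h t v → leftE t ≡ isPos h → botE t ≡ isPos v →
                 ∃ λ h′ → ∃ λ w → Local (λ _ _ → ⊤) h t v h′ w
  local-exists zero    blank   zero    _ _ = _ , _ , blank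
  local-exists zero    vert    (suc v) _ _ = _ , _ , vert
  local-exists zero    elbowBR (suc v) _ _ = _ , _ , bend
  local-exists (suc h) horiz   zero    _ _ = _ , _ , horiz
  local-exists (suc h) elbowLT zero    _ _ = _ , _ , rise
  local-exists (suc h) cross   (suc v) _ _ = _ , _ , cross _
  local-exists zero    cross   _    () _
  local-exists (suc _) vert    _    () _
  local-exists (suc _) blank   _    () _
  local-exists (suc _) elbowBR _    () _

  -- The conditions of `IsLTBPD` that survive removal of the top row. The width is a free `m`, since
  -- `maxV` may change when the first entry is dropped.
  record Joined (α : Vec ℕ n) (D : Grid n m) : Set where
    field
      horizMatch : ∀ r c → r < n → c < m → rightE (tileAt D r c) ≡ leftE (tileAt D r (suc c))
      vertMatch  : ∀ r c → r < n → c < m → botE (tileAt D r c) ≡ topE (tileAt D (suc r) c)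
      leftBdry   : ∀ r → r < n → leftE (tileAt D r 0) ≡ isPos (at α r)

  -- The left and bottom labels of a tile determine the other two, so a row can be filled from left
  -- to right. Matching edges guarantee that a tile receives nonzero labels exactly on the edges
  -- that it uses.
  row-exists : ∀ h (ts : Vec Tile m) vs → leftE (atD blank ts 0) ≡ isPos h →
               (∀ c → c < m → rightE (atD blank ts c) ≡ leftE (atD blank ts (suc c))) →
               (∀ c → c < m → botE (atD blank ts c) ≡ isPos (at vs c)) →
               ∃ (Row (λ _ _ → ⊤) h ts vs)
  row-exists zero [] [] e _ _ = _ , []
  row-exists h (t ∷ ts) (v ∷ vs) e hm vm with local-exists h t v e (vm 0 z<s)
  ... | h′ , w , l with row-exists h′ ts vs (trans (sym (hm 0 z<s)) (rightE-local l))
                                   (λ c lt → hm (suc c) (s≤s lt)) (λ c lt → vm (suc c) (s≤s lt))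
  ...   | ws , R = w ∷ ws , l ∷ R

  topE-lab : ∀ {α : Vec ℕ n} {D : Grid n m} {ws} (G : Lab P α D ws) c → c < m →
             topE (tileAt D 0 c) ≡ isPos (at ws c)
  topE-lab {m = m} [] c c<m =
    trans (cong topE (tileAt-below {m = m} [] {0} c z≤n)) (sym (cong isPos (at-replicate m c)))
  topE-lab (R ∷ G) c c<m = topE-local (local-row R c c<m)

  lab-exists : ∀ (α : Vec ℕ n) (D : Grid n m) → Joined α D → ∃ (Lab (λ _ _ → ⊤) α D)
  lab-exists [] [] j = _ , []
  lab-exists (a ∷ α) (ts ∷ D) j with lab-exists α D (record
    { horizMatch = λ r c lt → horizMatch (suc r) c (s≤s lt)
    ; vertMatch  = λ r c lt → vertMatch (suc r) c (s≤s lt)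
    ; leftBdry   = λ r lt → leftBdry (suc r) (s≤s lt) })
    where open Joined j
  ... | vs , G with row-exists a ts vs (leftBdry 0 z<s) (λ c → horizMatch 0 c z<s)
                      (λ c c<m → trans (vertMatch 0 c z<s c<m) (topE-lab G c c<m))
    where open Joined j
  ...   | ws , R = ws , R ∷ G

  lab-joined : ∀ {α : Vec ℕ n} {D : Grid n m} {ws} → Lab P α D ws → Joined α D
  lab-joined {n} {m} {α = α} {D} G = record
    { horizMatch = λ r c r<n c<m → trans (rightE-local (local G r c r<n c<m)) (sym (left r (suc c) r<n c<m))
    ; vertMatch  = λ r c r<n c<m → trans (botE-local (local G r c r<n c<m)) (sym (top (suc r) c r<n c<m))
    ; leftBdry   = λ r r<n → trans (left r 0 r<n z≤n) (cong isPos (H-left G r)) }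
    where
    left : ∀ r c → r < n → c ≤ m → leftE (tileAt D r c) ≡ isPos (H G r c)
    left r c r<n c≤m with m≤n⇒m<n∨m≡n c≤m
    ... | inj₁ c<m = leftE-local (local G r c r<n c<m)
    -- Outside the grid every tile is blank, in agreement with the label 0 of the right border.
    ... | inj₂ refl rewrite H-right G r = cong leftE (atD-≥ (atD (replicate m blank) D r) ≤-refl)
    top : ∀ r c → r ≤ n → c < m → topE (tileAt D r c) ≡ isPos (V G r c)
    top r c r≤n c<m with m≤n⇒m<n∨m≡n r≤n
    ... | inj₁ r<n = topE-local (local G r c r<n c<m)
    ... | inj₂ refl rewrite V-bottom G c = cong topE (tileAt-below D c ≤-refl)

  topLabels-zero : ∀ {n} m j (α : Vec ℕ n) → (∀ i → at α i ≤ j) → topLabels j m α ≡ replicate m 0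
  topLabels-zero zero    j α le = refl
  topLabels-zero (suc m) j α le rewrite occurrences-≢ (suc j) α (λ i _ → <⇒≢ (s≤s (le i))) =
    cong (0 ∷_) (topLabels-zero m (suc j) α (m≤n⇒m≤1+n ∘ le))

  ≡ᵇ-refl : ∀ i → (i ≡ᵇ i) ≡ true
  ≡ᵇ-refl zero    = refl
  ≡ᵇ-refl (suc i) = ≡ᵇ-refl i

  -- Enumerating all grids and computing their labels.

  tiles : List Tile
  tiles = blank ∷ vert ∷ elbowBR ∷ horiz ∷ elbowLT ∷ cross ∷ []

  rows : ∀ m → List (Vec Tile m)
  rows zero    = [] ∷ []
  rows (suc m) = cartesianProductWith _∷_ tiles (rows m)

  -- The lower rows vary outermost, in the order in which `gridSum` nests its sums.
  grids : ∀ n m → List (Grid n m)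
  grids zero    m = [] ∷ []
  grids (suc n) m = cartesianProductWith (λ D ts → ts ∷ D) (grids n m) (rows m)

  -- Functional form of `Local _<_`: a tile and its incoming labels determine the outgoing ones, or
  -- are incompatible. The test compares the predecessors of two nonzero labels.
  tileStep : ℕ → Tile → ℕ → Maybe (ℕ × ℕ)
  tileStep zero    blank   zero    = just (0 , 0)
  tileStep zero    vert    (suc v) = just (0 , suc v)
  tileStep zero    elbowBR (suc v) = just (suc v , 0)
  tileStep (suc h) horiz   zero    = just (suc h , 0)
  tileStep (suc h) elbowLT zero    = just (0 , suc h)
  tileStep (suc h) cross   (suc v) = if v <ᵇ h then just (suc h , suc v) else nothing
  tileStep _       _       _       = nothing

  runRow : ∀ {m} → ℕ → Vec Tile m → Vec ℕ m → Maybe (Vec ℕ m)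
  runRow h []       []       = if h ≡ᵇ 0 then just [] else nothing
  runRow h (t ∷ ts) (v ∷ vs) = tileStep h t v >>= λ (h′ , w) → Maybe.map (w ∷_) (runRow h′ ts vs)

  runGrid : ∀ {n m} → Vec ℕ n → Grid n m → Maybe (Vec ℕ m)
  runGrid []      []       = just (replicate _ 0)
  runGrid (a ∷ α) (ts ∷ D) = runGrid α D >>= runRow a ts

-- Pipes as paths of constant label.

module Tracing where

  open import Data.Bool.Properties using (∧-zeroʳ; ∨-zeroʳ)
  open import Data.Empty using (⊥; ⊥-elim)
  open import Data.List.Relation.Unary.Any using (here; there)
  open import Data.List.Relation.Unary.All as All using ([])
  open import Data.List.Relation.Unary.AllPairs using ([]; _∷_)
  open import Data.Nat using (_+_; _≤_; _<_)
  open import Data.Nat.Properties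
  open import Data.Unit using (tt)
  open import Relation.Binary.Definitions using (tri<; tri≈; tri>)
  open import Relation.Binary.PropositionalEquality
  open Labelling

  -- The case distinction of `trace` is local to it; this copy lets a lemma assume the direction in
  -- which a pipe leaves a tile.
  turn : Tile → Dir → Maybe Dir
  turn horiz   fromLeft   = just fromLeft
  turn cross   fromLeft   = just fromLeft
  turn elbowLT fromLeft   = just fromBottom
  turn vert    fromBottom = just fromBottom
  turn cross   fromBottom = just fromBottom
  turn elbowBR fromBottom = just fromLeft
  turn _       _          = nothing

  trace-exit : ∀ {n m} (D : Grid n m) k c d → turn (tileAt D 0 c) d ≡ just fromBottom →
               trace D (suc k) 0 c d ≡ ((0 , c) ∷ [] , exitTop (suc c))
  trace-exit D k c fromLeft e with tileAt D 0 c | e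
  ... | elbowLT | _ = refl
  trace-exit D k c fromBottom e with tileAt D 0 c | e
  ... | vert | _ = refl
  ... | cross | _ = refl

  trace-up : ∀ {n m} (D : Grid n m) k r c d {P o} → turn (tileAt D (suc r) c) d ≡ just fromBottom →
             trace D k r c fromBottom ≡ (P , o) →
             trace D (suc k) (suc r) c d ≡ ((suc r , c) ∷ P , o)
  trace-up D k r c fromLeft e refl with tileAt D (suc r) c | e
  ... | elbowLT | _ = refl
  trace-up D k r c fromBottom e refl with tileAt D (suc r) c | e
  ... | vert | _ = refl
  ... | cross | _ = refl

  trace-right : ∀ {n m} (D : Grid n m) k r c d {P o} → turn (tileAt D r c) d ≡ just fromLeft →
                trace D k r (suc c) fromLeft ≡ (P , o) →
                trace D (suc k) r c d ≡ ((r , c) ∷ P , o)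
  trace-right D k r c fromLeft e refl with tileAt D r c | e
  ... | horiz | _ = refl
  ... | cross | _ = refl
  trace-right D k r c fromBottom e refl with tileAt D r c | e
  ... | elbowBR | _ = refl

  Enters : Dir → ℕ → ℕ → ℕ → Set
  Enters fromLeft   h v a = h ≡ a
  Enters fromBottom h v a = v ≡ a

  module _ {P : ℕ → ℕ → Set} where

    -- The pipe and its label leave a tile through the same edge, so tracing a pipe means following
    -- its label.
    turn-forth : ∀ {h t v h′ w} a d → Local P h t v h′ w → Enters d h v (suc a) →
                 (turn t d ≡ just fromBottom × w ≡ suc a) ⊎ (turn t d ≡ just fromLeft × h′ ≡ suc a)
    turn-forth a fromBottom vert      e = inj₁ (refl , e)
    turn-forth a fromBottom bend      e = inj₂ (refl , e)
    turn-forth a fromLeft   horiz     e = inj₂ (refl , e)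
    turn-forth a fromLeft   rise      e = inj₁ (refl , e)
    turn-forth a fromLeft   (cross _) e = inj₂ (refl , e)
    turn-forth a fromBottom (cross _) e = inj₁ (refl , e)

    turn-back-left : ∀ {h t v h′ w} a → Local P h t v h′ w → h′ ≡ suc a →
                     ∃ λ d → turn t d ≡ just fromLeft × Enters d h v (suc a)
    turn-back-left a bend      e = fromBottom , refl , e
    turn-back-left a horiz     e = fromLeft , refl , e
    turn-back-left a (cross _) e = fromLeft , refl , e

    turn-back-up : ∀ {h t v h′ w} a → Local P h t v h′ w → w ≡ suc a →
                   ∃ λ d → turn t d ≡ just fromBottom × Enters d h v (suc a)
    turn-back-up a vert      e = fromBottom , refl , e
    turn-back-up a rise      e = fromLeft , refl , e
    turn-back-up a (cross _) e = fromBottom , refl , e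

  Cell : Set
  Cell = ℕ × ℕ

  module Paths {P : ℕ → ℕ → Set} {n m : ℕ} {α : Vec ℕ n} {D : Grid n m} {ws : Vec ℕ m} (G : Lab P α D ws) (a : ℕ) where

    At : ℕ → ℕ → Dir → Set
    At r c d = Enters d (H G r c) (V G (suc r) c) (suc a)

    -- A successful trace without fuel, indexed by the visited cells and the exit column, so that
    -- facts about pipes are proved by induction on it.
    data Path : ℕ → ℕ → Dir → List Cell → ℕ → Set where
      exit  : ∀ {c d} → 0 < n → c < m → At 0 c d → turn (tileAt D 0 c) d ≡ just fromBottom →
              V G 0 c ≡ suc a → Path 0 c d ((0 , c) ∷ []) c
      up    : ∀ {r c d Q e} → suc r < n → c < m → At (suc r) c d →
              turn (tileAt D (suc r) c) d ≡ just fromBottom →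
              Path r c fromBottom Q e → Path (suc r) c d ((suc r , c) ∷ Q) e
      right : ∀ {r c d Q e} → r < n → c < m → At r c d →
              turn (tileAt D r c) d ≡ just fromLeft →
              Path r (suc c) fromLeft Q e → Path r c d ((r , c) ∷ Q) e

    -- Each step lowers `r` or raises `c`, so `r + (m - c)` bounds the remaining steps. A pipe
    -- cannot leave on the right, where the label is 0.
    trace-path : ∀ k r c d → r < n → c < m → At r c d → r + m ≤ k + c →
                 ∃ λ Q → ∃ λ e → Path r c d Q e × trace D k r c d ≡ (Q , exitTop (suc e))
    trace-path zero r c d r<n c<m at le = contradiction (≤-trans (m≤n+m m r) le) (<⇒≱ c<m)
    trace-path (suc k) r c d r<n c<m at le with turn-forth a d (local G r c r<n c<m) at
    trace-path (suc k) zero c d r<n c<m at le | inj₁ (t , w) =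
      _ , _ , exit r<n c<m at t w , trace-exit D k c d t
    trace-path (suc k) (suc r) c d r<n c<m at le | inj₁ (t , w)
      with trace-path k r c fromBottom (<⇒≤ r<n) c<m w (s≤s⁻¹ le)
    ... | Q , e , p , eq = _ , e , up r<n c<m at t p , trace-up D k r c d t eq
    trace-path (suc k) r c d r<n c<m at le | inj₂ (t , h) with m≤n⇒m<n∨m≡n c<m
    ... | inj₂ refl with () ← trans (sym h) (H-right G r)
    ... | inj₁ lt with trace-path k r (suc c) fromLeft r<n lt h (≤-trans le (≤-reflexive (sym (+-suc k c))))
    ...   | Q , e , p , eq = _ , e , right r<n c<m at t p , trace-right D k r c d t eq

    path-exit : ∀ {r c d Q e} → Path r c d Q e → e < m × V G 0 e ≡ suc a
    path-exit (exit _ c<m _ _ v)  = c<m , v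
    path-exit (up _ _ _ _ p)    = path-exit p
    path-exit (right _ _ _ _ p) = path-exit p

    record Visited (r c r′ c′ : ℕ) : Set where
      constructor visited
      field
        r′≤r  : r′ ≤ r
        c≤c′  : c ≤ c′
        r′<n  : r′ < n
        c′<m  : c′ < m
        label : ∃ λ d → At r′ c′ d

    path-cell : ∀ {r c d Q e r′ c′} → Path r c d Q e → (r′ , c′) ∈ Q → Visited r c r′ c′
    path-cell (exit r<n c<m at _ _)  (here refl) = visited ≤-refl ≤-refl r<n c<m (_ , at)
    path-cell (up r<n c<m at _ _)    (here refl) = visited ≤-refl ≤-refl r<n c<m (_ , at)
    path-cell (right r<n c<m at _ _) (here refl) = visited ≤-refl ≤-refl r<n c<m (_ , at)
    path-cell (up _ _ _ _ p)    (there i) with path-cell p i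
    ... | visited x y z w l = visited (m≤n⇒m≤1+n x) y z w l
    path-cell (right _ _ _ _ p) (there i) with path-cell p i
    ... | visited x y z w l = visited x (<⇒≤ y) z w l

    -- After one step the path is strictly higher or strictly further to the right, and it never
    -- moves back.
    path-fresh : ∀ {r c d q Q e} → Path r c d (q ∷ Q) e → ¬ ((r , c) ∈ Q)
    path-fresh (up _ _ _ _ p)    i = n≮n _ (Visited.r′≤r (path-cell p i))
    path-fresh (right _ _ _ _ p) i = n≮n _ (Visited.c≤c′ (path-cell p i))

    path-unique : ∀ {r c d Q e} → Path r c d Q e → Unique Q
    path-unique (exit _ _ _ _ _) = [] ∷ []
    path-unique q@(up _ _ _ _ p)    = All.tabulate (λ i eq → path-fresh q (subst (_∈ _) (sym eq) i)) ∷ path-unique p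
    path-unique q@(right _ _ _ _ p) = All.tabulate (λ i eq → path-fresh q (subst (_∈ _) (sym eq) i)) ∷ path-unique p

    -- Unlike membership in `Q`, this remembers the side from which the cell is entered, as needed
    -- to exclude that a pipe crosses itself.
    data On (r₁ c₁ : ℕ) (d₁ : Dir) : ∀ {r c d Q e} → Path r c d Q e → Set where
      here   : ∀ {Q e} {p : Path r₁ c₁ d₁ Q e} → On r₁ c₁ d₁ p
      up     : ∀ {r c d Q e x y z t} {p : Path r c fromBottom Q e} → On r₁ c₁ d₁ p → On r₁ c₁ d₁ (up {d = d} x y z t p)
      right  : ∀ {r c d Q e x y z t} {p : Path r (suc c) fromLeft Q e} → On r₁ c₁ d₁ p → On r₁ c₁ d₁ (right {d = d} x y z t p)

    head-∈ : ∀ {r c d Q e} → Path r c d Q e → (r , c) ∈ Q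
    head-∈ (exit _ _ _ _ _) = here refl
    head-∈ (up _ _ _ _ _) = here refl
    head-∈ (right _ _ _ _ _) = here refl

    on-∈ : ∀ {r₁ c₁ d₁ r c d Q e} {p : Path r c d Q e} → On r₁ c₁ d₁ p → (r₁ , c₁) ∈ Q
    on-∈ {p = p} here = head-∈ p
    on-∈ (up o)       = there (on-∈ o)
    on-∈ (right o)    = there (on-∈ o)

    on-once : ∀ {r₁ c₁ d₁ d₂ r c d Q e} {p : Path r c d Q e} → On r₁ c₁ d₁ p → On r₁ c₁ d₂ p → d₁ ≡ d₂
    on-once here here = refl
    on-once {p = p} here (up o)    = contradiction (on-∈ o) (path-fresh p)
    on-once {p = p} here (right o) = contradiction (on-∈ o) (path-fresh p)
    on-once {p = p} (up o) here    = contradiction (on-∈ o) (path-fresh p)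
    on-once {p = p} (right o) here = contradiction (on-∈ o) (path-fresh p)
    on-once (up o)    (up o′)      = on-once o o′
    on-once (right o) (right o′)   = on-once o o′

    just-≢ : ∀ {x : Maybe Dir} → x ≡ just fromLeft → x ≡ just fromBottom → ⊥
    just-≢ refl ()

    on-up : ∀ {r₁ c₁ d₁ r c d Q e} {p : Path r c d Q e} → On (suc r₁) c₁ d₁ p →
            turn (tileAt D (suc r₁) c₁) d₁ ≡ just fromBottom → On r₁ c₁ fromBottom p
    on-up {p = up _ _ _ _ p}     here t = up here
    on-up {p = right _ _ _ t′ p} here t = ⊥-elim (just-≢ t′ t)
    on-up (up o) t = up (on-up o t)
    on-up (right o) t = right (on-up o t)

    on-right : ∀ {r₁ c₁ d₁ r c d Q e} {p : Path r c d Q e} → On r₁ c₁ d₁ p →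
               turn (tileAt D r₁ c₁) d₁ ≡ just fromLeft → On r₁ (suc c₁) fromLeft p
    on-right {p = exit _ _ _ t′ _} here t = ⊥-elim (just-≢ t t′)
    on-right {p = up _ _ _ t′ p} here t = ⊥-elim (just-≢ t t′)
    on-right {p = right _ _ _ _ p} here t = right here
    on-right (up o) t = up (on-right o t)
    on-right (right o) t = right (on-right o t)

    -- The label is followed backwards, with `(n - r) + c` bounding the steps. The bottom border
    -- carries only 0, so the walk ends on the left border; `on-up` and `on-right` show that a path
    -- starting there comes back to the given cell.
    origin : ∀ k r c d → r < n → c < m → At r c d → n + c ≤ k + r →
             ∃ λ r₀ → r₀ < n × at α r₀ ≡ suc a × (∀ {Q e} (p : Path r₀ 0 fromLeft Q e) → On r c d p)
    origin zero r c d r<n c<m at le = contradiction (≤-trans (m≤m+n n c) le) (<⇒≱ r<n)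
    origin (suc k) r zero fromLeft r<n c<m at le = r , r<n , trans (sym (H-left G r)) at , λ p → here
    origin (suc k) r (suc c) fromLeft r<n c<m at le
      with turn-back-left a (local G r c r<n (<⇒≤ c<m)) at
    ... | d , t , at′ with origin k r c d r<n (<⇒≤ c<m) at′ (s≤s⁻¹ (≤-trans (≤-reflexive (sym (+-suc n c))) le))
    ...   | r₀ , r₀<n , e , o = r₀ , r₀<n , e , λ p → on-right (o p) t
    origin (suc k) r c fromBottom r<n c<m at le with m≤n⇒m<n∨m≡n r<n
    ... | inj₂ refl with () ← trans (sym at) (V-bottom G c)
    ... | inj₁ lt with turn-back-up a (local G (suc r) c lt c<m) at
    ...   | d , t , at′ with origin k (suc r) c d lt c<m at′ (≤-trans le (≤-reflexive (sym (+-suc k r))))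
    ...     | r₀ , r₀<n , e , o = r₀ , r₀<n , e , λ p → on-up (o p) t

    -- Snowiness leaves only one row in which the label can enter, so every edge with this label
    -- lies on the one path.
    same-origin : Snowy α → ∀ {r₀ Q e r c} d → at α r₀ ≡ suc a → (p : Path r₀ 0 fromLeft Q e) →
                  r < n → c < m → At r c d → On r c d p
    same-origin s {r₀} {r = r} {c} d e p r<n c<m x with origin (n + c) r c d r<n c<m x (m≤m+n _ r)
    ... | r₁ , _ , e₁ , o with r₀ ≟ r₁
    ...   | yes refl = o p
    ...   | no ne    = contradiction (trans e (sym e₁)) (s _ _ ne (subst (0 <_) (sym e) z<s))

    pipe-path : ∀ {r} → r < n → at α r ≡ suc a →
                ∃ λ Q → ∃ λ e → Path r 0 fromLeft Q e × pipe D r ≡ (Q , exitTop (suc e))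
    pipe-path {r} r<n e = trace-path (n + m) r 0 fromLeft r<n (m>0 refl) (trans (H-left G r) e)
      (≤-trans (+-monoˡ-≤ m (<⇒≤ r<n)) (≤-reflexive (sym (+-identityʳ (n + m)))))
      where
      m>0 : ∀ {k} → k ≡ m → 0 < k
      m>0 {zero}  refl = contradiction (trans (sym (H-right G r)) (trans (H-left G r) e)) 0≢1+n
      m>0 {suc _} _    = z<s

  open Paths using (same-origin; pipe-path; path-exit; path-cell; path-unique; on-∈; on-once; origin; visited)

  ≢⇒≡ᵇ : ∀ {i j} → i ≢ j → (i ≡ᵇ j) ≡ false
  ≢⇒≡ᵇ {i} {j} ne with i ≡ᵇ j in eq
  ... | true  = contradiction (≡ᵇ⇒≡ i j (subst T (sym eq) tt)) ne
  ... | false = refl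

  elemB-∈ : ∀ {q : Cell} {Q} → elemB q Q ≡ true → q ∈ Q
  elemB-∈ {r , c} {(r′ , c′) ∷ Q} e with r ≟ r′ | c ≟ c′
  ... | yes refl | yes refl = here refl
  ... | no ne | _ rewrite ≢⇒≡ᵇ ne = there (elemB-∈ e)
  ... | yes refl | no ne rewrite ≢⇒≡ᵇ ne | ∧-zeroʳ (r ≡ᵇ r) = there (elemB-∈ e)

  ∈-elemB : ∀ {q : Cell} {Q} → q ∈ Q → elemB q Q ≡ true
  ∈-elemB {r , c} (here refl) rewrite ≡ᵇ-refl r | ≡ᵇ-refl c = refl
  ∈-elemB {r , c} {(r′ , c′) ∷ Q} (there i) rewrite ∈-elemB {r , c} i = ∨-zeroʳ _

  -- Counting the common crossings of two lists of cells.

  module _ {n m : ℕ} (D : Grid n m) (Q : List Cell) where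

    Common : Cell → Set
    Common (r , c) = tileAt D r c ≡ cross × (r , c) ∈ Q

    common-weight : Cell → ℕ
    common-weight (r , c) = if isCross (tileAt D r c) ∧ elemB (r , c) Q then 1 else 0

    weight-common : ∀ {q} → Common q → common-weight q ≡ 1
    weight-common {q} (t , i) rewrite t | ∈-elemB i = refl

    common-dec : ∀ q → Common q ⊎ common-weight q ≡ 0
    common-dec (r , c) with tileAt D r c in t | elemB (r , c) Q in e
    ... | cross   | true  = inj₁ (refl , elemB-∈ e)
    ... | cross   | false = inj₂ refl
    ... | blank   | _     = inj₂ refl
    ... | vert    | _     = inj₂ refl
    ... | horiz   | _     = inj₂ refl
    ... | elbowBR | _     = inj₂ refl
    ... | elbowLT | _     = inj₂ refl

    count-≥1 : ∀ {q R} → q ∈ R → Common q → 1 ≤ commonCrossings D R Q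
    count-≥1 (here refl) x rewrite weight-common x = z<s
    count-≥1 (there i)   x = ≤-trans (count-≥1 i x) (m≤n+m _ _)

    count-≥2 : ∀ {p q R} → p ≢ q → p ∈ R → q ∈ R → Common p → Common q → 2 ≤ commonCrossings D R Q
    count-≥2 ne (here refl) (here refl) x y = contradiction refl ne
    count-≥2 ne (here refl) (there j) x y rewrite weight-common x = s≤s (count-≥1 j y)
    count-≥2 ne (there i) (here refl) x y rewrite weight-common y = s≤s (count-≥1 i x)
    count-≥2 ne (there i) (there j) x y = ≤-trans (count-≥2 ne i j x y) (m≤n+m _ _)

    count-0 : ∀ R → (∀ {q} → q ∈ R → ¬ Common q) → commonCrossings D R Q ≡ 0
    count-0 []      none = refl
    count-0 (q ∷ R) none with common-dec q
    ... | inj₁ x = contradiction x (none (here refl))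
    ... | inj₂ e = cong₂ _+_ e (count-0 R (none ∘ there))

    count-≤1 : ∀ R → Unique R → (∀ {p q} → p ∈ R → q ∈ R → Common p → Common q → p ≡ q) →
               commonCrossings D R Q ≤ 1
    count-≤1 []      _        same = z≤n
    count-≤1 (q ∷ R) (f ∷ u) same with common-dec q
    ... | inj₁ x = ≤-reflexive (cong₂ _+_ (weight-common x)
                     (count-0 R (λ i y → All.lookup f i (same (here refl) (there i) x y))))
    ... | inj₂ e = subst (λ k → k + commonCrossings D R Q ≤ 1) (sym e) (count-≤1 R u (λ i j → same (there i) (there j)))

  Row-strict : ∀ {P h m} {ts : Vec Tile m} {vs ws} (R : Row P h ts vs ws) →
               (∀ c → c < m → atD blank ts c ≡ cross → at vs c < Hrow R c) → Row _<_ h ts vs ws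
  Row-strict []              f = []
  Row-strict (blank ∷ R)     f = blank ∷ Row-strict R (λ c lt → f (suc c) (s≤s lt))
  Row-strict (vert ∷ R)      f = vert ∷ Row-strict R (λ c lt → f (suc c) (s≤s lt))
  Row-strict (bend ∷ R)      f = bend ∷ Row-strict R (λ c lt → f (suc c) (s≤s lt))
  Row-strict (horiz ∷ R)     f = horiz ∷ Row-strict R (λ c lt → f (suc c) (s≤s lt))
  Row-strict (rise ∷ R)      f = rise ∷ Row-strict R (λ c lt → f (suc c) (s≤s lt))
  Row-strict (cross _ ∷ R)   f = cross (f 0 z<s refl) ∷ Row-strict R (λ c lt → f (suc c) (s≤s lt))

  -- The relation `P` enters a labelling only at crossings, so the order can be established
  -- afterwards, with the labels already at hand.
  Lab-strict : ∀ {P n m} {α : Vec ℕ n} {D : Grid n m} {ws} (G : Lab P α D ws) →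
               (∀ r c → r < n → c < m → tileAt D r c ≡ cross → V G (suc r) c < H G r c) → Lab _<_ α D ws
  Lab-strict []      f = []
  Lab-strict (R ∷ G) f = Row-strict R (λ c → f 0 c z<s) ∷ Lab-strict G (λ r c lt → f (suc r) c (s≤s lt))

  -- Equivalence of the global and the local description.

  module _ {n : ℕ} {α : Vec ℕ n} (snowy : Snowy α) {D : Grid n (maxV α)} where

    m₀ = maxV α

    -- The label of an occupied top edge comes from the pipe that `pipeExit` sends there, because a
    -- path carries its label to its exit.
    bpd⇒top : IsLTBPD α D → ∀ {P ws} → Lab P α D ws → ws ≡ topLabels 0 m₀ α
    bpd⇒top bpd {ws = ws} G = vec-ext ws _ top
      where
      open IsLTBPD bpd
      top : ∀ c → c < m₀ → at ws c ≡ at (topLabels 0 m₀ α) c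
      top c c<m with at ws c in e
      ... | zero with at (topLabels 0 m₀ α) c in f
      ...   | zero  = refl
      ...   | suc _ with topLabels-pos {m = m₀} 0 α c (subst (0 <_) (sym f) z<s)
      ...     | _ , i , αi with () ← trans (sym (topBdry₂ c i c<m αi)) (trans (topE-lab G c c<m) (cong isPos e))
      top c c<m | suc k with topBdry₁ c c<m (trans (topE-lab G c c<m) (cong isPos e))
      ... | i , αi with at-<⇒< α (subst (0 <_) (sym αi) z<s)
      ...   | i<n with pipe-path G c i<n αi
      ...     | Q , e′ , p , eq
                with trans (sym (cong proj₂ eq)) (trans (pipeExit i i<n (subst (0 <_) (sym αi) z<s)) (cong exitTop αi))
      ...       | refl = trans (sym e) (trans (proj₂ (path-exit G c p)) (sym (topLabels-present 0 α c i c<m αi)))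

    -- If some crossing has the wrong order, `inversions-lab` yields another crossing of the same
    -- labels in the right order, because the top word has no inversion; this contradicts
    -- `crossOnce`.
    bpd⇒lab : IsLTBPD α D → Lab _<_ α D (topLabels 0 m₀ α)
    bpd⇒lab bpd with lab-exists α D (record { horizMatch = horizMatch ; vertMatch = vertMatch ; leftBdry = leftBdry })
      where open IsLTBPD bpd
    ... | ws , G with bpd⇒top bpd G
    ...   | refl = Lab-strict G good
      where
      open IsLTBPD bpd
      good′ : ∀ r c → r < n → c < m₀ → tileAt D r c ≡ cross → ∀ a b → H G r c ≡ suc a → V G (suc r) c ≡ suc b → b < a
      good′ r c r<n c<m t a b h v with <-cmp b a
      ... | tri< lt _ _ = lt
      -- Equal labels would mean that one pipe enters the cell both from the left and from below.
      ... | tri≈ _ refl _ with origin G a (n + c) r c fromLeft r<n c<m h (m≤m+n _ r)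
      ...   | r₀ , r₀<n , e , o with pipe-path G a r₀<n e
      ...     | Q , _ , p , _ with () ← on-once G a (o p) (same-origin G a snowy fromBottom e p r<n c<m v)
      good′ r c r<n c<m t a b h v | tri> _ _ a<b
        with crossings-find G {suc b} {suc a} (subst (0 <_) (trans (inversions-lab b a G) (cong (_+ crossings (suc b) (suc a) G) (inversions-topLabels m₀ 0 b a α a<b)))
               (≤-trans (crossings-cross G (crossing r<n c<m t h v)) (m≤n+m _ _)))
      ... | r₂ , c₂ , crossing r₂<n c₂<m t₂ h₂ v₂
          with origin G a (n + c) r c fromLeft r<n c<m h (m≤m+n _ r) | origin G b (n + c) r c fromBottom r<n c<m v (m≤m+n _ r)
      ...   | ra , ra<n , ea , oa | rb , rb<n , eb , ob with pipe-path G a ra<n ea | pipe-path G b rb<n eb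
      ...     | Qa , _ , pa , eqa | Qb , _ , pb , eqb =
                contradiction (crossOnce ra rb ra<n rb<n ra≢rb (subst (0 <_) (sym ea) z<s) (subst (0 <_) (sym eb) z<s))
                  (<⇒≱ (subst₂ (λ x y → 2 ≤ commonCrossings D (proj₁ x) (proj₁ y)) (sym eqa) (sym eqb)
                    (count-≥2 D Qb cells≢ (on-∈ G a (oa pa)) (on-∈ G a (same-origin G a snowy fromBottom ea pa r₂<n c₂<m v₂))
                      (t , on-∈ G b (ob pb)) (t₂ , on-∈ G b (same-origin G b snowy fromLeft eb pb r₂<n c₂<m h₂)))))
        where
        ra≢rb : ra ≢ rb
        ra≢rb refl = <⇒≢ a<b (suc-injective (trans (sym ea) eb))
        -- The left label is `suc a` in the first cell and `suc b` in the second.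
        cells≢ : (r , c) ≢ (r₂ , c₂)
        cells≢ refl = <⇒≢ a<b (suc-injective (trans (sym h) h₂))
      good : ∀ r c → r < n → c < m₀ → tileAt D r c ≡ cross → V G (suc r) c < H G r c
      good r c r<n c<m t with H G r c in h | V G (suc r) c in v | cross-pos (local G r c r<n c<m) t
        where
        cross-pos : ∀ {P h t v h′ w} → Local P h t v h′ w → t ≡ cross → (∃ λ a → h ≡ suc a) × (∃ λ b → v ≡ suc b)
        cross-pos (cross _) _ = (_ , refl) , (_ , refl)
      ... | _ | _ | (a , refl) , (b , refl) = s≤s (good′ r c r<n c<m t a b h v)

    -- The rule at crossings makes the larger label horizontal at every common crossing of two
    -- pipes, and `inversions-lab` bounds the number of these by the inversions of α.
    lab⇒bpd : Lab _<_ α D (topLabels 0 m₀ α) → IsLTBPD α D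
    lab⇒bpd G = record
      { horizMatch = horizMatch ; vertMatch = vertMatch ; leftBdry = leftBdry
      ; topBdry₁ = λ c c<m e → proj₂ (topLabels-pos {m = m₀} 0 α c (isPos-< (trans (sym (topE-lab G c c<m)) e)))
      ; topBdry₂ = λ c i c<m e → trans (topE-lab G c c<m) (cong isPos (topLabels-present 0 α c i c<m e))
      ; pipeExit = pipeExit
      ; crossOnce = crossOnce }
      where
      open Joined (lab-joined G)
      isPos-< : ∀ {k} → isPos k ≡ true → 0 < k
      isPos-< {suc _} _ = z<s
      pipeExit : ∀ r → r < n → 0 < at α r → proj₂ (pipe D r) ≡ exitTop (at α r)
      pipeExit r r<n lt with at α r in e
      ... | suc a with pipe-path G a r<n e
      ...   | Q , c , p , eq with path-exit G a p
      ...     | c<m , v = trans (cong proj₂ eq) (cong exitTop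
                  (trans (sym (proj₁ (topLabels-pos {m = m₀} 0 α c (subst (0 <_) (sym v) z<s)))) v))
      cross-order : ∀ a b r c → a < b → r < n → c < m₀ → tileAt D r c ≡ cross →
                    (∃ λ d → Paths.At G a r c d) → (∃ λ d → Paths.At G b r c d) → Crossing G (suc b) (suc a) r c
      cross-order a b r c a<b r<n c<m t (fromLeft , x) (fromLeft , y) = contradiction (suc-injective (trans (sym x) y)) (<⇒≢ a<b)
      cross-order a b r c a<b r<n c<m t (fromBottom , x) (fromBottom , y) = contradiction (suc-injective (trans (sym x) y)) (<⇒≢ a<b)
      cross-order a b r c a<b r<n c<m t (fromBottom , x) (fromLeft , y) = crossing r<n c<m t y x
      cross-order a b r c a<b r<n c<m t (fromLeft , x) (fromBottom , y) =
        contradiction (s≤s⁻¹ (subst₂ _<_ y x (cross-holds (local G r c r<n c<m) t))) (<⇒≯ a<b)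
      crossings≤1 : ∀ a b → a < b → crossings (suc b) (suc a) G ≤ 1
      crossings≤1 a b a<b = begin
        crossings (suc b) (suc a) G                                      ≤⟨ m≤n+m _ _ ⟩
        inversions (suc b) (suc a) (topLabels 0 m₀ α) + crossings (suc b) (suc a) G   ≡⟨ inversions-lab b a G ⟨
        inversions (suc b) (suc a) α + crossings (suc a) (suc b) G              ≡⟨ cong (inversions (suc b) (suc a) α +_) (crossings-bad G (s≤s a<b)) ⟩
        inversions (suc b) (suc a) α + 0                                ≡⟨ +-identityʳ _ ⟩
        inversions (suc b) (suc a) α                                    ≤⟨ inversions-snowy b a α snowy ⟩
        1 ∎
        where open ≤-Reasoning
      crossOnce : ∀ r r′ → r < n → r′ < n → r ≢ r′ → 0 < at α r → 0 < at α r′ →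
                  commonCrossings D (proj₁ (pipe D r)) (proj₁ (pipe D r′)) ≤ 1
      crossOnce r r′ r<n r′<n r≢r′ lt lt′ with at α r in e | at α r′ in e′
      ... | suc a | suc b with pipe-path G a r<n e | pipe-path G b r′<n e′
      ...   | Q , _ , p , eq | Q′ , _ , p′ , eq′ rewrite eq | eq′ = count-≤1 D Q′ Q (path-unique G a p) same
        where
        a≢b : a ≢ b
        a≢b refl = snowy r r′ r≢r′ (subst (0 <_) (sym e) z<s) (trans e (sym e′))
        same : ∀ {q q′} → q ∈ Q → q′ ∈ Q → Common D Q′ q → Common D Q′ q′ → q ≡ q′
        same i j (t , i′) (t′ , j′)
          with path-cell G a p i | path-cell G a p j | path-cell G b p′ i′ | path-cell G b p′ j′ | <-cmp a b
        ... | visited _ _ r<n c<m x | visited _ _ r′<n c′<m y | visited _ _ _ _ x′ | visited _ _ _ _ y′ | tri< a<b _ _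
          with crossings-unique G (crossings≤1 a b a<b) (cross-order a b _ _ a<b r<n c<m t x x′) (cross-order a b _ _ a<b r′<n c′<m t′ y y′)
        ...   | refl , refl = refl
        same i j (t , i′) (t′ , j′)
            | visited _ _ r<n c<m x | visited _ _ r′<n c′<m y | visited _ _ _ _ x′ | visited _ _ _ _ y′ | tri> _ _ b<a
          with crossings-unique G (crossings≤1 b a b<a) (cross-order b a _ _ b<a r<n c<m t x′ x) (cross-order b a _ _ b<a r′<n c′<m t′ y′ y)
        ...   | refl , refl = refl
        same i j (t , i′) (t′ , j′) | _ | _ | _ | _ | tri≈ _ e _ = contradiction e a≢b

-- Multiplication operators on power series.

module Series where

  open import Algebra.Structures.Biased using (isCommutativeSemiringˡ)
  open import Data.Integer using () renaming (_+_ to _+ℤ_)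
  import Data.Integer as ℤ
  import Data.Integer.Properties as ℤₚ
  open import Data.Nat using (_<_)
  open import Data.Nat.Properties using (_≟_)
  open import Relation.Binary.Structures using (IsEquivalence)
  open import Relation.Binary.PropositionalEquality

  swapN : ℕ → ℕ → ℕ
  swapN zero    zero          = 1
  swapN zero    (suc zero)    = 0
  swapN zero    (suc (suc j)) = suc (suc j)
  swapN (suc i) zero          = 0
  swapN (suc i) (suc j)       = suc (swapN i j)

  mulVar-0 : ∀ {n} i (f : Poly n) γ → at γ i ≡ 0 → mulVar i f γ ≡ ℤ.0ℤ
  mulVar-0 i f γ e with at γ i | e
  ... | zero | _ = refl

  mulVar-suc : ∀ {n} i (f : Poly n) γ {k} → at γ i ≡ suc k → mulVar i f γ ≡ f (decAt i γ)
  mulVar-suc i f γ e with at γ i | e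
  ... | suc _ | _ = refl

  mulVar-cong : ∀ {n} i {f g : Poly n} → f ≈P g → mulVar i f ≈P mulVar i g
  mulVar-cong i e γ with at γ i
  ... | zero  = refl
  ... | suc _ = e _

  mulVar-+ : ∀ {n} i (f g : Poly n) → mulVar i (f +P g) ≈P (mulVar i f +P mulVar i g)
  mulVar-+ i f g γ with at γ i
  ... | zero  = refl
  ... | suc _ = refl

  mulVar-zeroP : ∀ {n} i → mulVar {n} i zeroP ≈P zeroP
  mulVar-zeroP i γ with at γ i
  ... | zero  = refl
  ... | suc _ = refl

  at-decAt : ∀ {n} i j (γ : Vec ℕ n) → i ≢ j → at (decAt i γ) j ≡ at γ j
  at-decAt i       j       []      ne = refl
  at-decAt zero    zero    (x ∷ γ) ne = contradiction refl ne
  at-decAt zero    (suc j) (x ∷ γ) ne = refl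
  at-decAt (suc i) zero    (x ∷ γ) ne = refl
  at-decAt (suc i) (suc j) (x ∷ γ) ne = at-decAt i j γ (ne ∘ cong suc)

  decAt-comm : ∀ {n} i j (γ : Vec ℕ n) → decAt i (decAt j γ) ≡ decAt j (decAt i γ)
  decAt-comm i       j       []      = refl
  decAt-comm zero    zero    (x ∷ γ) = refl
  decAt-comm zero    (suc j) (x ∷ γ) = refl
  decAt-comm (suc i) zero    (x ∷ γ) = refl
  decAt-comm (suc i) (suc j) (x ∷ γ) = cong (x ∷_) (decAt-comm i j γ)

  mulVar-comm : ∀ {n} i j (f : Poly n) → mulVar i (mulVar j f) ≈P mulVar j (mulVar i f)
  mulVar-comm i j f γ with i ≟ j
  ... | yes refl = refl
  ... | no ne with at γ i in e | at γ j in e′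
  ...   | zero  | zero  = refl
  ...   | zero  | suc _ = sym (mulVar-0 i f (decAt j γ) (trans (at-decAt j i γ (ne ∘ sym)) e))
  ...   | suc _ | zero  = mulVar-0 j f (decAt i γ) (trans (at-decAt i j γ ne) e′)
  ...   | suc _ | suc _ = trans (mulVar-suc j f (decAt i γ) (trans (at-decAt i j γ ne) e′))
            (trans (cong f (decAt-comm j i γ)) (sym (mulVar-suc i f (decAt j γ) (trans (at-decAt j i γ (ne ∘ sym)) e))))

  infixl 6 _⊕_
  infixl 7 _⊗_

  -- Polynomials with natural coefficients, kept as syntax so that an exchange of variables is the
  -- substitution `rename`.
  data Expr : Set where
    𝟘 𝟙     : Expr
    var     : ℕ → Expr
    _⊕_ _⊗_ : Expr → Expr → Expr

  ⟦_⟧ : ∀ {n} → Expr → Poly n → Poly n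
  ⟦ 𝟘 ⟧      f = zeroP
  ⟦ 𝟙 ⟧      f = f
  ⟦ var i ⟧  f = mulVar i f
  ⟦ d ⊕ e ⟧  f = ⟦ d ⟧ f +P ⟦ e ⟧ f
  ⟦ d ⊗ e ⟧  f = ⟦ d ⟧ (⟦ e ⟧ f)

  ⟦⟧-cong : ∀ {n} e {f g : Poly n} → f ≈P g → ⟦ e ⟧ f ≈P ⟦ e ⟧ g
  ⟦⟧-cong 𝟘       p γ = refl
  ⟦⟧-cong 𝟙       p   = p
  ⟦⟧-cong (var i) p   = mulVar-cong i p
  ⟦⟧-cong (d ⊕ e) p γ = cong₂ _+ℤ_ (⟦⟧-cong d p γ) (⟦⟧-cong e p γ)
  ⟦⟧-cong (d ⊗ e) p   = ⟦⟧-cong d (⟦⟧-cong e p)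

  +ℤ-interchange : ∀ a b c d → (a +ℤ b) +ℤ (c +ℤ d) ≡ (a +ℤ c) +ℤ (b +ℤ d)
  +ℤ-interchange a b c d = begin
    (a +ℤ b) +ℤ (c +ℤ d) ≡⟨ ℤₚ.+-assoc a b _ ⟩
    a +ℤ (b +ℤ (c +ℤ d)) ≡⟨ cong (a +ℤ_) (trans (sym (ℤₚ.+-assoc b c d)) (trans (cong (_+ℤ d) (ℤₚ.+-comm b c)) (ℤₚ.+-assoc c b d))) ⟩
    a +ℤ (c +ℤ (b +ℤ d)) ≡⟨ ℤₚ.+-assoc a c _ ⟨
    (a +ℤ c) +ℤ (b +ℤ d) ∎
    where open ≡-Reasoning

  ⟦⟧-+ : ∀ {n} e (f g : Poly n) → ⟦ e ⟧ (f +P g) ≈P (⟦ e ⟧ f +P ⟦ e ⟧ g)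
  ⟦⟧-+ 𝟘       f g γ = refl
  ⟦⟧-+ 𝟙       f g γ = refl
  ⟦⟧-+ (var i) f g γ = mulVar-+ i f g γ
  ⟦⟧-+ (d ⊕ e) f g γ = trans (cong₂ _+ℤ_ (⟦⟧-+ d f g γ) (⟦⟧-+ e f g γ)) (+ℤ-interchange (⟦ d ⟧ f γ) _ _ _)
  ⟦⟧-+ (d ⊗ e) f g γ = trans (⟦⟧-cong d (⟦⟧-+ e f g) γ) (⟦⟧-+ d _ _ γ)

  ⟦⟧-zeroP : ∀ {n} e → ⟦ e ⟧ (zeroP {n}) ≈P zeroP
  ⟦⟧-zeroP 𝟘       γ = refl
  ⟦⟧-zeroP 𝟙       γ = refl
  ⟦⟧-zeroP (var i) γ = mulVar-zeroP i γ
  ⟦⟧-zeroP (d ⊕ e) γ = cong₂ _+ℤ_ (⟦⟧-zeroP d γ) (⟦⟧-zeroP e γ)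
  ⟦⟧-zeroP (d ⊗ e) γ = trans (⟦⟧-cong d (⟦⟧-zeroP e) γ) (⟦⟧-zeroP d γ)

  var-comm : ∀ {n} i e (f : Poly n) → mulVar i (⟦ e ⟧ f) ≈P ⟦ e ⟧ (mulVar i f)
  var-comm i 𝟘       f γ = mulVar-zeroP i γ
  var-comm i 𝟙       f γ = refl
  var-comm i (var j) f γ = mulVar-comm i j f γ
  var-comm i (d ⊕ e) f γ = trans (mulVar-+ i (⟦ d ⟧ f) (⟦ e ⟧ f) γ) (cong₂ _+ℤ_ (var-comm i d f γ) (var-comm i e f γ))
  var-comm i (d ⊗ e) f γ = trans (var-comm i d (⟦ e ⟧ f) γ) (⟦⟧-cong d (var-comm i e f) γ)

  -- The operators arise by sums and composition from the commuting `mulVar i`; additivity `⟦⟧-+`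
  -- deals with the sums.
  ⟦⟧-comm : ∀ {n} d e (f : Poly n) → ⟦ d ⟧ (⟦ e ⟧ f) ≈P ⟦ e ⟧ (⟦ d ⟧ f)
  ⟦⟧-comm 𝟘       e f γ = sym (⟦⟧-zeroP e γ)
  ⟦⟧-comm 𝟙       e f γ = refl
  ⟦⟧-comm (var i) e f γ = var-comm i e f γ
  ⟦⟧-comm (c ⊕ d) e f γ = trans (cong₂ _+ℤ_ (⟦⟧-comm c e f γ) (⟦⟧-comm d e f γ)) (sym (⟦⟧-+ e _ _ γ))
  ⟦⟧-comm (c ⊗ d) e f γ = trans (⟦⟧-cong c (⟦⟧-comm d e f) γ) (⟦⟧-comm c e (⟦ d ⟧ f) γ)

  -- Two expressions are identified when they act in the same way on power series in n variables;
  -- this avoids defining the product of power series.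
  exprSemiring : ℕ → CommutativeSemiring 0ℓ 0ℓ
  exprSemiring n = record
    { Carrier = Expr
    ; _≈_ = λ d e → ∀ (f : Poly n) → ⟦ d ⟧ f ≈P ⟦ e ⟧ f
    ; _+_ = _⊕_
    ; _*_ = _⊗_
    ; 0# = 𝟘
    ; 1# = 𝟙
    ; isCommutativeSemiring = isCommutativeSemiringˡ record
      { +-isCommutativeMonoid = record
        { isMonoid = record
          { isSemigroup = record
            { isMagma = record
              { isEquivalence = equiv
              ; ∙-cong = λ p q f γ → cong₂ _+ℤ_ (p f γ) (q f γ) }
            ; assoc = λ c d e f γ → ℤₚ.+-assoc (⟦ c ⟧ f γ) _ _ }
          ; identity = (λ e f γ → ℤₚ.+-identityˡ _) , (λ e f γ → ℤₚ.+-identityʳ _) }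
        ; comm = λ d e f γ → ℤₚ.+-comm (⟦ d ⟧ f γ) _ }
      ; *-isCommutativeMonoid = record
        { isMonoid = record
          { isSemigroup = record
            { isMagma = record
              { isEquivalence = equiv
              ; ∙-cong = λ {c} {d} p q f γ → trans (p _ γ) (⟦⟧-cong d (q f) γ) }
            ; assoc = λ c d e f γ → refl }
          ; identity = (λ e f γ → refl) , (λ e f γ → refl) }
        ; comm = ⟦⟧-comm }
      ; distribʳ = λ c d e f γ → refl
      ; zeroˡ = λ e f γ → refl }
    }
    where
    equiv : IsEquivalence (λ d e → ∀ (f : Poly n) → ⟦ d ⟧ f ≈P ⟦ e ⟧ f)
    equiv = record { refl = λ f γ → refl ; sym = λ p f γ → sym (p f γ) ; trans = λ p q f γ → trans (p f γ) (q f γ) }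

  rename : (ℕ → ℕ) → Expr → Expr
  rename σ 𝟘       = 𝟘
  rename σ 𝟙       = 𝟙
  rename σ (var i) = var (σ i)
  rename σ (d ⊕ e) = rename σ d ⊕ rename σ e
  rename σ (d ⊗ e) = rename σ d ⊗ rename σ e

  at-swapV : ∀ {n} i j (γ : Vec ℕ n) → suc i < n → at (swapV i γ) j ≡ at γ (swapN i j)
  at-swapV zero    zero          (x ∷ y ∷ γ) _ = refl
  at-swapV zero    (suc zero)    (x ∷ y ∷ γ) _ = refl
  at-swapV zero    (suc (suc j)) (x ∷ y ∷ γ) _ = refl
  at-swapV (suc i) zero          (x ∷ γ)     _ = refl
  at-swapV (suc i) (suc j)       (x ∷ γ)     (s≤s lt) = at-swapV i j γ lt
  at-swapV zero    _             (x ∷ [])    (s≤s ())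

  decAt-swapV : ∀ {n} i j (γ : Vec ℕ n) → suc i < n → decAt j (swapV i γ) ≡ swapV i (decAt (swapN i j) γ)
  decAt-swapV zero    zero          (x ∷ y ∷ γ) _ = refl
  decAt-swapV zero    (suc zero)    (x ∷ y ∷ γ) _ = refl
  decAt-swapV zero    (suc (suc j)) (x ∷ y ∷ γ) _ = refl
  decAt-swapV (suc i) zero          (x ∷ γ)     _ = refl
  decAt-swapV (suc i) (suc j)       (x ∷ γ)     (s≤s lt) = cong (x ∷_) (decAt-swapV i j γ lt)
  decAt-swapV zero    _             (x ∷ [])    (s≤s ())

  swapP-mulVar : ∀ {n} i j (f : Poly n) → suc i < n → swapP i (mulVar j f) ≈P mulVar (swapN i j) (swapP i f)
  swapP-mulVar i j f lt γ with at γ (swapN i j) in e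
  ... | zero  = mulVar-0 j f (swapV i γ) (trans (at-swapV i j γ lt) e)
  ... | suc _ = trans (mulVar-suc j f (swapV i γ) (trans (at-swapV i j γ lt) e)) (cong f (decAt-swapV i j γ lt))

  -- The bound matters: at the last position `swapV i` is the identity, whereas `rename` would
  -- introduce a variable out of range, which acts as 0.
  swapP-⟦⟧ : ∀ {n} i e (f : Poly n) → suc i < n → swapP i (⟦ e ⟧ f) ≈P ⟦ rename (swapN i) e ⟧ (swapP i f)
  swapP-⟦⟧ i 𝟘       f lt γ = refl
  swapP-⟦⟧ i 𝟙       f lt γ = refl
  swapP-⟦⟧ i (var j) f lt γ = swapP-mulVar i j f lt γ
  swapP-⟦⟧ i (d ⊕ e) f lt γ = cong₂ _+ℤ_ (swapP-⟦⟧ i d f lt γ) (swapP-⟦⟧ i e f lt γ)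
  swapP-⟦⟧ i (d ⊗ e) f lt γ =
    trans (swapP-⟦⟧ i d (⟦ e ⟧ f) lt γ) (⟦⟧-cong (rename (swapN i) d) (swapP-⟦⟧ i e f lt) γ)

-- Row transfer operators over a commutative semiring.

module Transfer {c ℓ : Level} (R : CommutativeSemiring c ℓ) where

  import Data.List as List
  import Data.Nat as ℕ
  import Data.Nat.Properties as ℕₚ
  open import Relation.Binary.PropositionalEquality as ≡ using (_≡_)
  open CommutativeSemiring R hiding (zero)
  open import Algebra.Solver.Ring.NaturalCoefficients.Default R using (solve; _:+_; _:*_; _:=_; con)
  open import Relation.Binary.Reasoning.Setoid setoid
  open Labelling
  open Series using (swapN)

  -- The sum over one row of tiles, with a factor x for every non-blank tile, left label h and
  -- bottom labels vs; the continuation φ is evaluated at the top labels.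
  rowSum : Carrier → ℕ → ∀ {m} → Vec ℕ m → (Vec ℕ m → Carrier) → Carrier
  rowSum x zero    []           φ = φ []
  rowSum x (suc h) []           φ = 0#
  rowSum x zero    (zero  ∷ vs) φ = rowSum x zero vs (φ ∘ (zero ∷_))
  rowSum x zero    (suc v ∷ vs) φ =
    x * rowSum x zero vs (φ ∘ (suc v ∷_)) + x * rowSum x (suc v) vs (φ ∘ (zero ∷_))
  rowSum x (suc h) (zero  ∷ vs) φ =
    x * rowSum x (suc h) vs (φ ∘ (zero ∷_)) + x * rowSum x zero vs (φ ∘ (suc h ∷_))
  rowSum x (suc h) (suc v ∷ vs) φ =
    if v <ᵇ h then x * rowSum x (suc h) vs (φ ∘ (suc v ∷_)) else 0#

  -- A row needs the labels below it, so the lower rows are summed outermost and the top row becomes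
  -- part of their continuation.
  gridSum : ∀ {n m} → (ℕ → Carrier) → Vec ℕ n → (Vec ℕ m → Carrier) → Carrier
  gridSum x []      φ = φ (replicate _ 0)
  gridSum x (a ∷ α) φ = gridSum (x ∘ suc) α (λ vs → rowSum (x 0) a vs φ)

  rowSum-cong : ∀ x h {m} (vs : Vec ℕ m) {φ ψ} → (∀ ws → φ ws ≈ ψ ws) → rowSum x h vs φ ≈ rowSum x h vs ψ
  rowSum-cong x zero    []           e = e []
  rowSum-cong x (suc h) []           e = refl
  rowSum-cong x zero    (zero ∷ vs)  e = rowSum-cong x zero vs (e ∘ _)
  rowSum-cong x zero    (suc v ∷ vs) e =
    +-cong (*-congˡ (rowSum-cong x zero vs (e ∘ _))) (*-congˡ (rowSum-cong x (suc v) vs (e ∘ _)))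
  rowSum-cong x (suc h) (zero ∷ vs)  e =
    +-cong (*-congˡ (rowSum-cong x (suc h) vs (e ∘ _))) (*-congˡ (rowSum-cong x zero vs (e ∘ _)))
  rowSum-cong x (suc h) (suc v ∷ vs) e with v <ᵇ h
  ... | true  = *-congˡ (rowSum-cong x (suc h) vs (e ∘ _))
  ... | false = refl

  interchange : ∀ x a b a′ b′ → x * (a + b) + x * (a′ + b′) ≈ (x * a + x * a′) + (x * b + x * b′)
  interchange = solve 5 (λ x a b a′ b′ → x :* (a :+ b) :+ x :* (a′ :+ b′)
    := (x :* a :+ x :* a′) :+ (x :* b :+ x :* b′)) refl

  rowSum-+ : ∀ x h {m} (vs : Vec ℕ m) φ ψ → rowSum x h vs (λ ws → φ ws + ψ ws) ≈ rowSum x h vs φ + rowSum x h vs ψ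
  rowSum-+ x zero    []           φ ψ = refl
  rowSum-+ x (suc h) []           φ ψ = sym (+-identityˡ 0#)
  rowSum-+ x zero    (zero ∷ vs)  φ ψ = rowSum-+ x zero vs _ _
  rowSum-+ x zero    (suc v ∷ vs) φ ψ =
    trans (+-cong (*-congˡ (rowSum-+ x zero vs _ _)) (*-congˡ (rowSum-+ x (suc v) vs _ _))) (interchange _ _ _ _ _)
  rowSum-+ x (suc h) (zero ∷ vs)  φ ψ =
    trans (+-cong (*-congˡ (rowSum-+ x (suc h) vs _ _)) (*-congˡ (rowSum-+ x zero vs _ _))) (interchange _ _ _ _ _)
  rowSum-+ x (suc h) (suc v ∷ vs) φ ψ with v <ᵇ h
  ... | true  = trans (*-congˡ (rowSum-+ x (suc h) vs _ _)) (distribˡ _ _ _)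
  ... | false = sym (+-identityˡ 0#)

  *-scalar : ∀ x k a → x * (k * a) ≈ k * (x * a)
  *-scalar = solve 3 (λ x k a → x :* (k :* a) := k :* (x :* a)) refl

  *-scalar-+ : ∀ x k a b → x * (k * a) + x * (k * b) ≈ k * (x * a + x * b)
  *-scalar-+ = solve 4 (λ x k a b → x :* (k :* a) :+ x :* (k :* b) := k :* (x :* a :+ x :* b)) refl

  rowSum-* : ∀ x h {m} (vs : Vec ℕ m) k φ → rowSum x h vs (λ ws → k * φ ws) ≈ k * rowSum x h vs φ
  rowSum-* x zero    []           k φ = refl
  rowSum-* x (suc h) []           k φ = sym (zeroʳ k)
  rowSum-* x zero    (zero ∷ vs)  k φ = rowSum-* x zero vs k _
  rowSum-* x zero    (suc v ∷ vs) k φ =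
    trans (+-cong (*-congˡ (rowSum-* x zero vs k _)) (*-congˡ (rowSum-* x (suc v) vs k _))) (*-scalar-+ _ _ _ _)
  rowSum-* x (suc h) (zero ∷ vs)  k φ =
    trans (+-cong (*-congˡ (rowSum-* x (suc h) vs k _)) (*-congˡ (rowSum-* x zero vs k _))) (*-scalar-+ _ _ _ _)
  rowSum-* x (suc h) (suc v ∷ vs) k φ with v <ᵇ h
  ... | true  = trans (*-congˡ (rowSum-* x (suc h) vs k _)) (*-scalar _ _ _)
  ... | false = sym (zeroʳ k)

  rowSum-0 : ∀ x h {m} (vs : Vec ℕ m) φ → (∀ ws → φ ws ≈ 0#) → rowSum x h vs φ ≈ 0#
  rowSum-0 x h vs φ e = begin
    rowSum x h vs φ                     ≈⟨ rowSum-cong x h vs (λ ws → trans (e ws) (sym (zeroˡ _))) ⟩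
    rowSum x h vs (λ ws → 0# * 0#)      ≈⟨ rowSum-* x h vs 0# _ ⟩
    0# * rowSum x h vs (λ _ → 0#)       ≈⟨ zeroˡ _ ⟩
    0#                              ∎

  gridSum-cong : ∀ {n m} x (α : Vec ℕ n) {φ ψ : Vec ℕ m → Carrier} →
              (∀ ws → φ ws ≈ ψ ws) → gridSum x α φ ≈ gridSum x α ψ
  gridSum-cong x []      e = e _
  gridSum-cong x (a ∷ α) e = gridSum-cong _ α (λ vs → rowSum-cong (x 0) a vs e)

  gridSum-+ : ∀ {n m} x (α : Vec ℕ n) (φ ψ : Vec ℕ m → Carrier) →
           gridSum x α (λ ws → φ ws + ψ ws) ≈ gridSum x α φ + gridSum x α ψ
  gridSum-+ x []      φ ψ = refl
  gridSum-+ x (a ∷ α) φ ψ = trans (gridSum-cong _ α (λ vs → rowSum-+ (x 0) a vs φ ψ)) (gridSum-+ _ α _ _)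

  gridSum-* : ∀ {n m} x (α : Vec ℕ n) k (φ : Vec ℕ m → Carrier) →
           gridSum x α (λ ws → k * φ ws) ≈ k * gridSum x α φ
  gridSum-* x []      k φ = refl
  gridSum-* x (a ∷ α) k φ = trans (gridSum-cong _ α (λ vs → rowSum-* (x 0) a vs k φ)) (gridSum-* _ α k _)

  -- The exchange relation for two adjacent rows.

  twoRows : Carrier → Carrier → ℕ → ℕ → ∀ {m} → Vec ℕ m → (Vec ℕ m → Carrier) → Carrier
  twoRows x y h₁ h₂ vs φ = rowSum y h₂ vs (λ us → rowSum x h₁ us φ)

  rowSum-*+ : ∀ y h {m} (vs : Vec ℕ m) x φ ψ →
          rowSum y h vs (λ ws → x * φ ws + x * ψ ws) ≈ x * rowSum y h vs φ + x * rowSum y h vs ψ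
  rowSum-*+ y h vs x φ ψ = trans (rowSum-+ y h vs _ _) (+-cong (rowSum-* y h vs x φ) (rowSum-* y h vs x ψ))

  -- The crossing rule as a coefficient, which the semiring solver can treat as an atom.
  κ : ℕ → ℕ → Carrier
  κ v h = if v <ᵇ h then 1# else 0#

  if-κ : ∀ v h a → (if v <ᵇ h then a else 0#) ≈ κ v h * a
  if-κ v h a with v <ᵇ h
  ... | true  = sym (*-identityˡ a)
  ... | false = sym (zeroˡ a)

  κ-< : ∀ {v h} → v ℕ.< h → κ v h ≈ 1#
  κ-< {v} {h} v<h with v <ᵇ h | ℕₚ.<⇒<ᵇ v<h
  ... | true | _ = refl

  κ-≥ : ∀ {v h} → h ℕ.≤ v → κ v h ≈ 0#
  κ-≥ {v} {h} h≤v with v <ᵇ h in e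
  ... | true  with () ← ℕₚ.<⇒≱ (ℕₚ.<ᵇ⇒< v h (≡.subst T (≡.sym e) _)) h≤v
  ... | false = refl

  module Column {m : ℕ} (vs : Vec ℕ m) (φ : Vec ℕ (suc m) → Carrier) where

    -- What remains after the first column, which passes on the labels `p` in the upper row and `q`
    -- in the lower row and has the top label `w`.
    Z : Carrier → Carrier → ℕ → ℕ → ℕ → Carrier
    Z x y p q w = twoRows x y p q vs (φ ∘ (w ∷_))

    -- In these names the three letters stand for the upper left, lower left and bottom labels, `s`
    -- meaning nonzero. The summands are the fillings of a column of two tiles.
    twoRows-00s : ∀ x y d → let c = suc d in twoRows x y 0 0 (c ∷ vs) φ ≈
             y * (x * Z x y 0 0 c + x * Z x y c 0 0) + y * Z x y 0 c 0
    twoRows-00s x y d = +-congʳ (*-congˡ (rowSum-*+ y 0 vs x _ _))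

    twoRows-s00 : ∀ x y d → let b = suc d in twoRows x y b 0 (0 ∷ vs) φ ≈
             x * Z x y b 0 0 + x * Z x y 0 0 b
    twoRows-s00 x y d = rowSum-*+ y 0 vs x _ _

    twoRows-0s0 : ∀ x y d → let b = suc d in twoRows x y 0 b (0 ∷ vs) φ ≈
             y * Z x y 0 b 0 + y * (x * Z x y 0 0 b + x * Z x y b 0 0)
    twoRows-0s0 x y d = +-congˡ (*-congˡ (rowSum-*+ y 0 vs x _ _))

    cross-row : ∀ x y h d e → let b = suc d ; c = suc e in
                rowSum y h vs (λ us → rowSum x b (c ∷ us) φ) ≈ x * (κ e d * Z x y b h c)
    cross-row x y h d e = begin
      rowSum y h vs (λ us → rowSum x (suc d) (suc e ∷ us) φ)
        ≈⟨ rowSum-cong y h vs (λ us → trans (if-κ e d _) (*-scalar _ _ _)) ⟩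
      rowSum y h vs (λ us → x * (κ e d * rowSum x (suc d) us (φ ∘ (suc e ∷_))))
        ≈⟨ rowSum-* y h vs x _ ⟩
      x * rowSum y h vs (λ us → κ e d * rowSum x (suc d) us (φ ∘ (suc e ∷_)))
        ≈⟨ *-congˡ (rowSum-* y h vs (κ e d) _) ⟩
      x * (κ e d * Z x y (suc d) h (suc e)) ∎

    twoRows-s0s : ∀ x y d e → let b = suc d ; c = suc e in twoRows x y b 0 (c ∷ vs) φ ≈
             y * (x * (κ e d * Z x y b 0 c)) + y * (x * Z x y b c 0 + x * Z x y 0 c b)
    twoRows-s0s x y d e = +-cong (*-congˡ (cross-row x y 0 d e)) (*-congˡ (rowSum-*+ y (suc e) vs x _ _))

    twoRows-0ss : ∀ x y d e → let b = suc d ; c = suc e in twoRows x y 0 b (c ∷ vs) φ ≈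
             κ e d * (y * (x * Z x y 0 b c + x * Z x y c b 0))
    twoRows-0ss x y d e = trans (if-κ e d _) (*-congˡ (*-congˡ (rowSum-*+ y (suc d) vs x _ _)))

    twoRows-ss0 : ∀ x y d e → let p = suc d ; q = suc e in twoRows x y p q (0 ∷ vs) φ ≈
             y * (x * Z x y p q 0 + x * Z x y 0 q p) + y * (x * (κ e d * Z x y p 0 q))
    twoRows-ss0 x y d e = +-cong (*-congˡ (rowSum-*+ y (suc e) vs x _ _)) (*-congˡ (cross-row x y 0 d e))

    twoRows-sss : ∀ x y d e k → let p = suc d ; q = suc e ; c = suc k in twoRows x y p q (c ∷ vs) φ ≈
             κ k e * (y * (x * (κ k d * Z x y p q c)))
    twoRows-sss x y d e k = trans (if-κ k e _) (*-congˡ (*-congˡ (cross-row x y (suc e) d k)))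

  mutual

    -- The exchange relation of the header with all terms moved so that no subtraction occurs.
    twoRows-exch : ∀ x y {m} (vs : Vec ℕ m) φ {a b} → a ℕ.< b →
              (x * y) * twoRows x y b a vs φ + y * twoRows x y a b vs φ ≈
              (x * y) * twoRows y x b a vs φ + x * twoRows x y a b vs φ
    twoRows-exch x y [] φ {zero} {suc b} _ =
      +-cong (trans (zeroʳ _) (sym (zeroʳ _))) (trans (zeroʳ _) (sym (zeroʳ _)))
    twoRows-exch x y [] φ {suc a} {suc b} _ =
      +-cong (trans (zeroʳ _) (sym (zeroʳ _))) (trans (zeroʳ _) (sym (zeroʳ _)))
    twoRows-exch x y (zero ∷ vs) φ {zero} {suc b} a<b = begin
      (x * y) * twoRows x y (suc b) 0 (0 ∷ vs) φ + y * twoRows x y 0 (suc b) (0 ∷ vs) φ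
        ≈⟨ +-cong (*-congˡ (twoRows-s00 x y b)) (*-congˡ (twoRows-0s0 x y b)) ⟩
      (x * y) * (x * P + x * W) + y * (y * Q + y * (x * W + x * P))
        ≈⟨ solve 5 (λ x y P Q W → (x :* y) :* (x :* P :+ x :* W) :+ y :* (y :* Q :+ y :* (x :* W :+ x :* P))
             := y :* ((x :* y) :* P :+ y :* Q) :+ (x :* x :* y :* P :+ x :* x :* y :* W :+ x :* y :* y :* W)) refl x y P Q W ⟩
      y * ((x * y) * P + y * Q) + (x * x * y * P + x * x * y * W + x * y * y * W)
        ≈⟨ +-congʳ (*-congˡ (twoRows-exch x y vs _ a<b)) ⟩
      y * ((x * y) * P′ + x * Q) + (x * x * y * P + x * x * y * W + x * y * y * W)
        ≈⟨ solve 6 (λ x y P Q W P′ → 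
             y :* ((x :* y) :* P′ :+ x :* Q) :+ (x :* x :* y :* P :+ x :* x :* y :* W :+ x :* y :* y :* W)
             := (x :* y) :* (y :* P′ :+ y :* W) :+ x :* (y :* Q :+ y :* (x :* W :+ x :* P))) refl x y P Q W P′ ⟩
      (x * y) * (y * P′ + y * W) + x * (y * Q + y * (x * W + x * P))
        ≈⟨ +-congʳ (*-congˡ (+-congˡ (*-congˡ (twoRows-sym x y vs _ 0)))) ⟩
      (x * y) * (y * P′ + y * Z y x 0 0 (suc b)) + x * (y * Q + y * (x * W + x * P))
        ≈⟨ +-cong (*-congˡ (twoRows-s00 y x b)) (*-congˡ (twoRows-0s0 x y b)) ⟨
      (x * y) * twoRows y x (suc b) 0 (0 ∷ vs) φ + x * twoRows x y 0 (suc b) (0 ∷ vs) φ ∎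
      where
      open Column vs φ
      P = Z x y (suc b) 0 0
      P′ = Z y x (suc b) 0 0
      Q = Z x y 0 (suc b) 0
      W = Z x y 0 0 (suc b)
    twoRows-exch x y (suc e ∷ vs) φ {zero} {suc b} a<b = begin
      (x * y) * twoRows x y (suc b) 0 (suc e ∷ vs) φ + y * twoRows x y 0 (suc b) (suc e ∷ vs) φ
        ≈⟨ +-cong (*-congˡ (twoRows-s0s x y b e)) (*-congˡ (twoRows-0ss x y b e)) ⟩
      (x * y) * (y * (x * (k * P)) + y * (x * A + x * B)) + y * (k * (y * (x * Q + x * C)))
        ≈⟨ solve 8 (λ x y k P Q A B C →
             (x :* y) :* (y :* (x :* (k :* P)) :+ y :* (x :* A :+ x :* B)) :+ y :* (k :* (y :* (x :* Q :+ x :* C)))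
             := (x :* y) :* (k :* ((x :* y) :* P :+ y :* Q) :+ ((x :* y) :* A :+ y :* (k :* C)) :+ (x :* y) :* B)) refl x y k P Q A B C ⟩
      (x * y) * (k * ((x * y) * P + y * Q) + ((x * y) * A + y * (k * C)) + (x * y) * B)
        -- The order of `suc e` and `suc b` is unknown, so the pair `A`, `C` needs `twoRows-κ`,
        -- where `κ (suc e) (suc b)` computes to `k`; `B` has the smaller label above and is
        -- symmetric.
        ≈⟨ *-congˡ (+-cong (+-cong (*-congˡ (twoRows-exch x y vs _ a<b)) (twoRows-κ x y vs _ (suc e) b))
                           (*-congˡ (twoRows-≤ x y vs _ {0} {suc e} z≤n))) ⟩
      (x * y) * (k * ((x * y) * P′ + x * Q) + ((x * y) * A′ + x * (k * C)) + (x * y) * B′)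
        ≈⟨ solve 8 (λ x y k P Q A B C →
             (x :* y) :* (k :* ((x :* y) :* P :+ x :* Q) :+ ((x :* y) :* A :+ x :* (k :* C)) :+ (x :* y) :* B)
             := (x :* y) :* (x :* (y :* (k :* P)) :+ x :* (y :* A :+ y :* B)) :+ x :* (k :* (y :* (x :* Q :+ x :* C)))) refl x y k P′ Q A′ B′ C ⟩
      (x * y) * (x * (y * (k * P′)) + x * (y * A′ + y * B′)) + x * (k * (y * (x * Q + x * C)))
        ≈⟨ +-cong (*-congˡ (twoRows-s0s y x b e)) (*-congˡ (twoRows-0ss x y b e)) ⟨
      (x * y) * twoRows y x (suc b) 0 (suc e ∷ vs) φ + x * twoRows x y 0 (suc b) (suc e ∷ vs) φ ∎
      where
      open Column vs φ
      k = κ e b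
      P = Z x y (suc b) 0 (suc e)
      P′ = Z y x (suc b) 0 (suc e)
      Q = Z x y 0 (suc b) (suc e)
      A = Z x y (suc b) (suc e) 0
      A′ = Z y x (suc b) (suc e) 0
      B = Z x y 0 (suc e) (suc b)
      B′ = Z y x 0 (suc e) (suc b)
      C = Z x y (suc e) (suc b) 0
    twoRows-exch x y (zero ∷ vs) φ {suc a} {suc b} (s≤s a<b) = begin
      (x * y) * twoRows x y (suc b) (suc a) (0 ∷ vs) φ + y * twoRows x y (suc a) (suc b) (0 ∷ vs) φ
        -- If the lower pipe rises, the upper one must cross it, which is allowed only with the
        -- larger label in the upper row; so this term survives for `b` above `a` and vanishes for
        -- `a` above `b`.
        ≈⟨ +-cong (*-congˡ (trans (twoRows-ss0 x y b a) (+-congˡ (*-congˡ (*-congˡ (trans (*-congʳ (κ-< a<b)) (*-identityˡ _)))))))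
                  (*-congˡ (trans (twoRows-ss0 x y a b) (trans (+-congˡ (*-congˡ (*-congˡ (trans (*-congʳ (κ-≥ (ℕₚ.<⇒≤ a<b))) (zeroˡ _))))) z0))) ⟩
      (x * y) * (y * (x * P + x * A) + y * (x * B)) + y * (y * (x * Q + x * C))
        ≈⟨ solve 7 (λ x y P Q A B C →
             (x :* y) :* (y :* (x :* P :+ x :* A) :+ y :* (x :* B)) :+ y :* (y :* (x :* Q :+ x :* C))
             := (x :* y) :* (((x :* y) :* P :+ y :* Q) :+ (x :* y) :* A :+ ((x :* y) :* B :+ y :* C))) refl x y P Q A B C ⟩
      (x * y) * (((x * y) * P + y * Q) + (x * y) * A + ((x * y) * B + y * C))
        ≈⟨ *-congˡ (+-cong (+-cong (twoRows-exch x y vs _ (s≤s a<b)) (*-congˡ (twoRows-≤ x y vs _ {0} {suc a} z≤n))) (twoRows-exch x y vs _ (s≤s z≤n))) ⟩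
      (x * y) * (((x * y) * P′ + x * Q) + (x * y) * A′ + ((x * y) * B′ + x * C))
        ≈⟨ solve 7 (λ x y P Q A B C →
             (x :* y) :* (((x :* y) :* P :+ x :* Q) :+ (x :* y) :* A :+ ((x :* y) :* B :+ x :* C))
             := (x :* y) :* (x :* (y :* P :+ y :* A) :+ x :* (y :* B)) :+ x :* (y :* (x :* Q :+ x :* C))) refl x y P′ Q A′ B′ C ⟩
      (x * y) * (x * (y * P′ + y * A′) + x * (y * B′)) + x * (y * (x * Q + x * C))
        ≈⟨ +-cong (*-congˡ (trans (twoRows-ss0 y x b a) (+-congˡ (*-congˡ (*-congˡ (trans (*-congʳ (κ-< a<b)) (*-identityˡ _)))))))
                  (*-congˡ (trans (twoRows-ss0 x y a b) (trans (+-congˡ (*-congˡ (*-congˡ (trans (*-congʳ (κ-≥ (ℕₚ.<⇒≤ a<b))) (zeroˡ _))))) z0))) ⟨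
      (x * y) * twoRows y x (suc b) (suc a) (0 ∷ vs) φ + x * twoRows x y (suc a) (suc b) (0 ∷ vs) φ ∎
      where
      open Column vs φ
      P = Z x y (suc b) (suc a) 0
      P′ = Z y x (suc b) (suc a) 0
      Q = Z x y (suc a) (suc b) 0
      A = Z x y 0 (suc a) (suc b)
      A′ = Z y x 0 (suc a) (suc b)
      B = Z x y (suc b) 0 (suc a)
      B′ = Z y x (suc b) 0 (suc a)
      C = Z x y 0 (suc b) (suc a)
      z0 : ∀ {u v w} → u + v * (w * 0#) ≈ u
      z0 = trans (+-congˡ (trans (*-congˡ (zeroʳ _)) (zeroʳ _))) (+-identityʳ _)
    twoRows-exch x y (suc e ∷ vs) φ {suc a} {suc b} a<b = begin
      (x * y) * twoRows x y (suc b) (suc a) (suc e ∷ vs) φ + y * twoRows x y (suc a) (suc b) (suc e ∷ vs) φ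
        ≈⟨ +-cong (*-congˡ (twoRows-sss x y b a e)) (*-congˡ (twoRows-sss x y a b e)) ⟩
      (x * y) * (k * (y * (x * (l * P)))) + y * (l * (y * (x * (k * Q))))
        ≈⟨ solve 6 (λ x y k l P Q → (x :* y) :* (k :* (y :* (x :* (l :* P)))) :+ y :* (l :* (y :* (x :* (k :* Q))))
             := (k :* l :* x :* y) :* ((x :* y) :* P :+ y :* Q)) refl x y k l P Q ⟩
      (k * l * x * y) * ((x * y) * P + y * Q)
        ≈⟨ *-congˡ (twoRows-exch x y vs _ a<b) ⟩
      (k * l * x * y) * ((x * y) * P′ + x * Q)
        ≈⟨ solve 6 (λ x y k l P Q → (k :* l :* x :* y) :* ((x :* y) :* P :+ x :* Q)
             := (x :* y) :* (k :* (x :* (y :* (l :* P)))) :+ x :* (l :* (y :* (x :* (k :* Q))))) refl x y k l P′ Q ⟩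
      (x * y) * (k * (x * (y * (l * P′)))) + x * (l * (y * (x * (k * Q))))
        ≈⟨ +-cong (*-congˡ (twoRows-sss y x b a e)) (*-congˡ (twoRows-sss x y a b e)) ⟨
      (x * y) * twoRows y x (suc b) (suc a) (suc e ∷ vs) φ + x * twoRows x y (suc a) (suc b) (suc e ∷ vs) φ ∎
      where
      open Column vs φ
      k = κ e a
      l = κ e b
      P = Z x y (suc b) (suc a) (suc e)
      P′ = Z y x (suc b) (suc a) (suc e)
      Q = Z x y (suc a) (suc b) (suc e)

    -- Either the exchange relation applies, or the coefficient vanishes and the remaining terms
    -- agree by symmetry.
    twoRows-κ : ∀ x y {m} (vs : Vec ℕ m) φ c b → let k = κ c (suc b) in
           (x * y) * twoRows x y (suc b) c vs φ + y * (k * twoRows x y c (suc b) vs φ) ≈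
           (x * y) * twoRows y x (suc b) c vs φ + x * (k * twoRows x y c (suc b) vs φ)
    twoRows-κ x y vs φ c b with ℕₚ.<-≤-connex c (suc b)
    ... | inj₁ c<b = begin
      (x * y) * twoRows x y (suc b) c vs φ + y * (κ c (suc b) * twoRows x y c (suc b) vs φ)
        ≈⟨ +-congˡ (*-congˡ (trans (*-congʳ (κ-< c<b)) (*-identityˡ _))) ⟩
      (x * y) * twoRows x y (suc b) c vs φ + y * twoRows x y c (suc b) vs φ
        ≈⟨ twoRows-exch x y vs φ c<b ⟩
      (x * y) * twoRows y x (suc b) c vs φ + x * twoRows x y c (suc b) vs φ
        ≈⟨ +-congˡ (*-congˡ (trans (*-congʳ (κ-< c<b)) (*-identityˡ _))) ⟨
      (x * y) * twoRows y x (suc b) c vs φ + x * (κ c (suc b) * twoRows x y c (suc b) vs φ) ∎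
    ... | inj₂ b≤c = +-cong (*-congˡ (twoRows-≤ x y vs φ b≤c))
                            (trans (vanish y) (sym (vanish x)))
      where
      vanish : ∀ z → z * (κ c (suc b) * twoRows x y c (suc b) vs φ) ≈ 0#
      vanish z = trans (*-congˡ (trans (*-congʳ (κ-≥ b≤c)) (zeroˡ _))) (zeroʳ z)

    twoRows-≤ : ∀ x y {m} (vs : Vec ℕ m) φ {a b} → a ℕ.≤ b → twoRows x y a b vs φ ≈ twoRows y x a b vs φ
    twoRows-≤ x y vs φ {a} a≤b with ℕₚ.m≤n⇒m<n∨m≡n a≤b
    ... | inj₁ a<b     = twoRows-< x y vs φ a<b
    ... | inj₂ ≡.refl  = twoRows-sym x y vs φ a

    -- In a ring where `x - y` can be cancelled, adding the exchange relations for `(x, y)` and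
    -- `(y, x)` gives this; in a semiring it needs its own induction.
    twoRows-< : ∀ x y {m} (vs : Vec ℕ m) φ {a b} → a ℕ.< b → twoRows x y a b vs φ ≈ twoRows y x a b vs φ
    twoRows-< x y [] φ {zero} {suc b} _ = refl
    twoRows-< x y [] φ {suc a} {suc b} _ = refl
    twoRows-< x y (zero ∷ vs) φ {zero} {suc b} a<b = begin
      twoRows x y 0 (suc b) (0 ∷ vs) φ ≈⟨ twoRows-0s0 x y b ⟩
      y * Q + y * (x * W + x * P)
        ≈⟨ solve 5 (λ x y P Q W → y :* Q :+ y :* (x :* W :+ x :* P) := ((x :* y) :* P :+ y :* Q) :+ (x :* y) :* W) refl x y P Q W ⟩
      ((x * y) * P + y * Q) + (x * y) * W
        -- The exchange relation turns `P` into `P′` and at the same time the factor `y` of `Q` into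
        -- `x`.
        ≈⟨ +-cong (trans (twoRows-exch x y vs _ a<b) (+-congˡ (*-congˡ (twoRows-< x y vs _ a<b)))) (*-congˡ (twoRows-sym x y vs _ 0)) ⟩
      ((x * y) * P′ + x * Q′) + (x * y) * W′
        ≈⟨ solve 5 (λ x y P Q W → ((x :* y) :* P :+ x :* Q) :+ (x :* y) :* W := x :* Q :+ x :* (y :* W :+ y :* P)) refl x y P′ Q′ W′ ⟩
      x * Q′ + x * (y * W′ + y * P′) ≈⟨ twoRows-0s0 y x b ⟨
      twoRows y x 0 (suc b) (0 ∷ vs) φ ∎
      where
      open Column vs φ
      P = Z x y (suc b) 0 0
      P′ = Z y x (suc b) 0 0
      Q = Z x y 0 (suc b) 0
      Q′ = Z y x 0 (suc b) 0
      W = Z x y 0 0 (suc b)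
      W′ = Z y x 0 0 (suc b)
    twoRows-< x y (suc e ∷ vs) φ {zero} {suc b} a<b = begin
      twoRows x y 0 (suc b) (suc e ∷ vs) φ ≈⟨ twoRows-0ss x y b e ⟩
      k * (y * (x * Q + x * C))
        ≈⟨ solve 5 (λ x y k Q C → k :* (y :* (x :* Q :+ x :* C)) := (x :* y) :* (k :* Q :+ k :* C)) refl x y k Q C ⟩
      (x * y) * (k * Q + k * C)
        ≈⟨ *-congˡ (+-cong (*-congˡ (twoRows-< x y vs _ a<b)) kC) ⟩
      (x * y) * (k * Q′ + k * C′)
        ≈⟨ solve 5 (λ x y k Q C → (x :* y) :* (k :* Q :+ k :* C) := k :* (x :* (y :* Q :+ y :* C))) refl x y k Q′ C′ ⟩
      k * (x * (y * Q′ + y * C′)) ≈⟨ twoRows-0ss y x b e ⟨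
      twoRows y x 0 (suc b) (suc e ∷ vs) φ ∎
      where
      open Column vs φ
      k = κ e b
      Q = Z x y 0 (suc b) (suc e)
      Q′ = Z y x 0 (suc b) (suc e)
      C = Z x y (suc e) (suc b) 0
      C′ = Z y x (suc e) (suc b) 0
      kC : k * C ≈ k * C′
      kC with ℕₚ.<-≤-connex e b
      ... | inj₁ e<b = *-congˡ (twoRows-< x y vs _ (s≤s e<b))
      ... | inj₂ b≤e = trans (trans (*-congʳ (κ-≥ b≤e)) (zeroˡ _)) (sym (trans (*-congʳ (κ-≥ b≤e)) (zeroˡ _)))
    twoRows-< x y (zero ∷ vs) φ {suc a} {suc b} (s≤s a<b) =
      twoRows-ss0-sym x y vs φ (ℕₚ.<⇒≤ a<b) (twoRows-< x y vs _ (s≤s a<b)) (twoRows-< x y vs _ (s≤s z≤n))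
    twoRows-< x y (suc e ∷ vs) φ {suc a} {suc b} a<b = twoRows-sss-sym x y vs φ (twoRows-< x y vs _ a<b)

    twoRows-sym : ∀ x y {m} (vs : Vec ℕ m) φ a → twoRows x y a a vs φ ≈ twoRows y x a a vs φ
    twoRows-sym x y [] φ zero = refl
    twoRows-sym x y [] φ (suc a) = refl
    twoRows-sym x y (zero ∷ vs) φ zero = twoRows-sym x y vs _ 0
    twoRows-sym x y (suc e ∷ vs) φ zero = begin
      twoRows x y 0 0 (suc e ∷ vs) φ ≈⟨ twoRows-00s x y e ⟩
      y * (x * W + x * P) + y * Q
        ≈⟨ solve 5 (λ x y P Q W → y :* (x :* W :+ x :* P) :+ y :* Q := ((x :* y) :* P :+ y :* Q) :+ (x :* y) :* W) refl x y P Q W ⟩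
      ((x * y) * P + y * Q) + (x * y) * W
        ≈⟨ +-cong (trans (twoRows-exch x y vs _ (s≤s z≤n)) (+-congˡ (*-congˡ (twoRows-< x y vs _ (s≤s z≤n))))) (*-congˡ (twoRows-sym x y vs _ 0)) ⟩
      ((x * y) * P′ + x * Q′) + (x * y) * W′
        ≈⟨ solve 5 (λ x y P Q W → ((x :* y) :* P :+ x :* Q) :+ (x :* y) :* W := x :* (y :* W :+ y :* P) :+ x :* Q) refl x y P′ Q′ W′ ⟩
      x * (y * W′ + y * P′) + x * Q′ ≈⟨ twoRows-00s y x e ⟨
      twoRows y x 0 0 (suc e ∷ vs) φ ∎
      where
      open Column vs φ
      P = Z x y (suc e) 0 0
      P′ = Z y x (suc e) 0 0
      Q = Z x y 0 (suc e) 0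
      Q′ = Z y x 0 (suc e) 0
      W = Z x y 0 0 (suc e)
      W′ = Z y x 0 0 (suc e)
    twoRows-sym x y (zero ∷ vs) φ (suc a) =
      twoRows-ss0-sym x y vs φ ℕₚ.≤-refl (twoRows-sym x y vs _ (suc a)) (twoRows-< x y vs _ (s≤s z≤n))
    twoRows-sym x y (suc e ∷ vs) φ (suc a) = twoRows-sss-sym x y vs φ (twoRows-sym x y vs _ (suc a))

    -- For `a ≤ b` the lower pipe cannot rise in this column, since the upper one would have to
    -- cross it without having the larger label. Only the two symmetric terms are left.
    twoRows-ss0-sym : ∀ x y {m} (vs : Vec ℕ m) φ {a b} → a ℕ.≤ b → let open Column vs φ in
                 Z x y (suc a) (suc b) 0 ≈ Z y x (suc a) (suc b) 0 →
                 Z x y 0 (suc b) (suc a) ≈ Z y x 0 (suc b) (suc a) →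
                 twoRows x y (suc a) (suc b) (0 ∷ vs) φ ≈ twoRows y x (suc a) (suc b) (0 ∷ vs) φ
    twoRows-ss0-sym x y vs φ {a} {b} a≤b p q = begin
      twoRows x y (suc a) (suc b) (0 ∷ vs) φ ≈⟨ expand x y ⟩
      y * (x * Z x y (suc a) (suc b) 0 + x * Z x y 0 (suc b) (suc a))
        ≈⟨ *-congˡ (+-cong (*-congˡ p) (*-congˡ q)) ⟩
      y * (x * Z y x (suc a) (suc b) 0 + x * Z y x 0 (suc b) (suc a))
        ≈⟨ solve 4 (λ x y P Q → y :* (x :* P :+ x :* Q) := x :* (y :* P :+ y :* Q)) refl x y _ _ ⟩
      x * (y * Z y x (suc a) (suc b) 0 + y * Z y x 0 (suc b) (suc a)) ≈⟨ expand y x ⟨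
      twoRows y x (suc a) (suc b) (0 ∷ vs) φ ∎
      where
      open Column vs φ
      expand : ∀ x y → twoRows x y (suc a) (suc b) (0 ∷ vs) φ ≈
             y * (x * Z x y (suc a) (suc b) 0 + x * Z x y 0 (suc b) (suc a))
      expand x y = trans (twoRows-ss0 x y a b) (trans (+-congˡ (trans
        (*-congˡ (trans (*-congˡ (trans (*-congʳ (κ-≥ a≤b)) (zeroˡ _))) (zeroʳ _))) (zeroʳ _))) (+-identityʳ _))

    twoRows-sss-sym : ∀ x y {m} (vs : Vec ℕ m) φ {a b e} → let open Column vs φ in
                 Z x y (suc a) (suc b) (suc e) ≈ Z y x (suc a) (suc b) (suc e) →
                 twoRows x y (suc a) (suc b) (suc e ∷ vs) φ ≈ twoRows y x (suc a) (suc b) (suc e ∷ vs) φ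
    twoRows-sss-sym x y vs φ {a} {b} {e} p = begin
      twoRows x y (suc a) (suc b) (suc e ∷ vs) φ ≈⟨ twoRows-sss x y a b e ⟩
      κ e b * (y * (x * (κ e a * Z x y (suc a) (suc b) (suc e))))
        ≈⟨ *-congˡ (*-congˡ (*-congˡ (*-congˡ p))) ⟩
      κ e b * (y * (x * (κ e a * Z y x (suc a) (suc b) (suc e))))
        ≈⟨ *-congˡ (*-exchange _ _ _) ⟩
      κ e b * (x * (y * (κ e a * Z y x (suc a) (suc b) (suc e))))
        ≈⟨ twoRows-sss y x a b e ⟨
      twoRows y x (suc a) (suc b) (suc e ∷ vs) φ ∎
      where
      open Column vs φ
      *-exchange : ∀ a b c → a * (b * c) ≈ b * (a * c)
      *-exchange = solve 3 (λ a b c → a :* (b :* c) := b :* (a :* c)) refl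

  -- The rows above the pair are absorbed into the arbitrary continuation of `twoRows-exch`; the
  -- rows below form an outer sum, through which the relation passes by linearity.
  gridSum-exch : ∀ {n m} x (α : Vec ℕ n) i (φ : Vec ℕ m → Carrier) → at α i ℕ.< at α (suc i) →
              (x i * x (suc i)) * gridSum x (swapV i α) φ + x (suc i) * gridSum x α φ ≈
              (x i * x (suc i)) * gridSum (x ∘ swapN i) (swapV i α) φ + x i * gridSum x α φ
  gridSum-exch x (a ∷ b ∷ α) zero φ a<b = begin
    p * q * gridSum x (b ∷ a ∷ α) φ + q * gridSum x (a ∷ b ∷ α) φ
      ≈⟨ +-cong (gridSum-* x″ α _ _) (gridSum-* x″ α _ _) ⟨
    gridSum x″ α (λ vs → p * q * twoRows p q b a vs φ) + gridSum x″ α (λ vs → q * twoRows p q a b vs φ)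
      ≈⟨ gridSum-+ x″ α _ _ ⟨
    gridSum x″ α (λ vs → p * q * twoRows p q b a vs φ + q * twoRows p q a b vs φ)
      ≈⟨ gridSum-cong x″ α (λ vs → twoRows-exch p q vs φ a<b) ⟩
    gridSum x″ α (λ vs → p * q * twoRows q p b a vs φ + p * twoRows p q a b vs φ)
      ≈⟨ gridSum-+ x″ α _ _ ⟩
    gridSum x″ α (λ vs → p * q * twoRows q p b a vs φ) + gridSum x″ α (λ vs → p * twoRows p q a b vs φ)
      ≈⟨ +-cong (gridSum-* x″ α _ _) (gridSum-* x″ α _ _) ⟩
    p * q * gridSum (x ∘ swapN 0) (b ∷ a ∷ α) φ + p * gridSum x (a ∷ b ∷ α) φ ∎
    where
    p = x 0
    q = x 1
    x″ = x ∘ suc ∘ suc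
  gridSum-exch x (a ∷ α) (suc i) φ lt = gridSum-exch (x ∘ suc) α i _ lt

  -- The transfer product as a weighted sum over grids.

  pow : Carrier → ℕ → Carrier
  pow x zero    = 1#
  pow x (suc k) = x * pow x k

  monomial : ∀ {n} → (ℕ → Carrier) → Vec ℕ n → Carrier
  monomial x []      = 1#
  monomial x (a ∷ α) = monomial (x ∘ suc) α * pow (x 0) a

  ∑ : ∀ {A : Set} → List A → (A → Carrier) → Carrier
  ∑ []       f = 0#
  ∑ (a ∷ as) f = f a + ∑ as f

  ∑-cong : ∀ {A : Set} (as : List A) {f g : A → Carrier} → (∀ a → f a ≈ g a) → ∑ as f ≈ ∑ as g
  ∑-cong []       e = refl
  ∑-cong (a ∷ as) e = +-cong (e a) (∑-cong as e)

  ∑-* : ∀ {A : Set} (as : List A) k (f : A → Carrier) → ∑ as (λ a → k * f a) ≈ k * ∑ as f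
  ∑-* []       k f = sym (zeroʳ k)
  ∑-* (a ∷ as) k f = trans (+-congˡ (∑-* as k f)) (sym (distribˡ k _ _))

  ∑-0 : ∀ {A : Set} (as : List A) → ∑ as (λ _ → 0#) ≈ 0#
  ∑-0 []       = refl
  ∑-0 (a ∷ as) = trans (+-identityˡ _) (∑-0 as)

  ∑-++ : ∀ {A : Set} (as bs : List A) f → ∑ (as List.++ bs) f ≈ ∑ as f + ∑ bs f
  ∑-++ []       bs f = sym (+-identityˡ _)
  ∑-++ (a ∷ as) bs f = trans (+-congˡ (∑-++ as bs f)) (sym (+-assoc _ _ _))

  ∑-map : ∀ {A B : Set} (h : A → B) (as : List A) f → ∑ (List.map h as) f ≈ ∑ as (f ∘ h)
  ∑-map h []       f = refl
  ∑-map h (a ∷ as) f = +-congˡ (∑-map h as f)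

  ∑-product : ∀ {A B C : Set} (h : A → B → C) as bs f →
              ∑ (List.cartesianProductWith h as bs) f ≈ ∑ as (λ a → ∑ bs (λ b → f (h a b)))
  ∑-product h []       bs f = refl
  ∑-product h (a ∷ as) bs f =
    trans (∑-++ (List.map (h a) bs) _ f) (+-cong (∑-map (h a) bs f) (∑-product h as bs f))

  tileWeight : Carrier → Tile → Carrier
  tileWeight x blank = 1#
  tileWeight x _     = x

  pow-rowCount : ∀ x t {m} (ts : Vec Tile m) → pow x (rowCount (t ∷ ts)) ≈ tileWeight x t * pow x (rowCount ts)
  pow-rowCount x blank   ts = sym (*-identityˡ _)
  pow-rowCount x elbowBR ts = refl
  pow-rowCount x elbowLT ts = refl
  pow-rowCount x cross   ts = refl
  pow-rowCount x horiz   ts = refl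
  pow-rowCount x vert    ts = refl

  after : ∀ {A : Set} → (A → Carrier) → Maybe A → Carrier
  after φ (just a) = φ a
  after φ nothing  = 0#

  -- The cases of `rowSum` are matched with the six entries of `tiles`; those incompatible with the
  -- labels contribute the zeros in the solver goals.
  rowSum-tiles : ∀ x h v {m} (vs : Vec ℕ m) φ →
             rowSum x h (v ∷ vs) φ ≈ ∑ tiles (λ t → after (λ (h′ , w) → tileWeight x t * rowSum x h′ vs (φ ∘ (w ∷_))) (tileStep h t v))
  rowSum-tiles x zero zero vs φ = solve 1 (λ a → a := con 1 :* a :+ (con 0 :+ (con 0 :+ (con 0 :+ (con 0 :+ (con 0 :+ con 0)))))) refl _
  rowSum-tiles x zero (suc v) vs φ = solve 2 (λ a b → a :+ b := con 0 :+ (a :+ (b :+ (con 0 :+ (con 0 :+ (con 0 :+ con 0)))))) refl _ _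
  rowSum-tiles x (suc h) zero vs φ = solve 2 (λ a b → a :+ b := con 0 :+ (con 0 :+ (con 0 :+ (a :+ (b :+ (con 0 :+ con 0)))))) refl _ _
  rowSum-tiles x (suc h) (suc v) vs φ with v <ᵇ h
  ... | true  = solve 1 (λ a → a := con 0 :+ (con 0 :+ (con 0 :+ (con 0 :+ (con 0 :+ (a :+ con 0)))))) refl _
  ... | false = solve 0 (con 0 := con 0 :+ (con 0 :+ (con 0 :+ (con 0 :+ (con 0 :+ (con 0 :+ con 0)))))) refl

  rowSum-∑ : ∀ x h {m} (vs : Vec ℕ m) φ →
         rowSum x h vs φ ≈ ∑ (rows m) (λ ts → pow x (rowCount ts) * after φ (runRow h ts vs))
  rowSum-∑ x zero    [] φ = solve 1 (λ a → a := con 1 :* a :+ con 0) refl _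
  rowSum-∑ x (suc h) [] φ = solve 0 (con 0 := con 1 :* con 0 :+ con 0) refl
  rowSum-∑ x h {suc m} (v ∷ vs) φ = begin
    rowSum x h (v ∷ vs) φ ≈⟨ rowSum-tiles x h v vs φ ⟩
    ∑ tiles (λ t → after (λ (h′ , w) → tileWeight x t * rowSum x h′ vs (φ ∘ (w ∷_))) (tileStep h t v))
      ≈⟨ ∑-cong tiles expand ⟩
    ∑ tiles (λ t → ∑ (rows m) (λ ts → pow x (rowCount (t ∷ ts)) * after φ (runRow h (t ∷ ts) (v ∷ vs))))
      ≈⟨ ∑-product _∷_ tiles (rows m) _ ⟨
    ∑ (rows (suc m)) (λ ts → pow x (rowCount ts) * after φ (runRow h ts (v ∷ vs))) ∎
    where
    after-map : ∀ w (r : Maybe (Vec ℕ m)) → after (φ ∘ (w ∷_)) r ≈ after φ (Maybe.map (w ∷_) r)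
    after-map w (just _) = refl
    after-map w nothing  = refl
    expand : ∀ t → after (λ (h′ , w) → tileWeight x t * rowSum x h′ vs (φ ∘ (w ∷_))) (tileStep h t v) ≈
                   ∑ (rows m) (λ ts → pow x (rowCount (t ∷ ts)) * after φ (runRow h (t ∷ ts) (v ∷ vs)))
    expand t with tileStep h t v
    ... | nothing = sym (trans (∑-cong (rows m) (λ ts → zeroʳ _)) (∑-0 (rows m)))
    ... | just (h′ , w) = begin
      tileWeight x t * rowSum x h′ vs (φ ∘ (w ∷_)) ≈⟨ *-congˡ (rowSum-∑ x h′ vs _) ⟩
      tileWeight x t * ∑ (rows m) (λ ts → pow x (rowCount ts) * after (φ ∘ (w ∷_)) (runRow h′ ts vs)) ≈⟨ ∑-* (rows m) _ _ ⟨
      ∑ (rows m) (λ ts → tileWeight x t * (pow x (rowCount ts) * after (φ ∘ (w ∷_)) (runRow h′ ts vs)))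
        ≈⟨ ∑-cong (rows m) (λ ts → trans (sym (*-assoc _ _ _)) (*-cong (sym (pow-rowCount x t ts)) (after-map w (runRow h′ ts vs)))) ⟩
      ∑ (rows m) (λ ts → pow x (rowCount (t ∷ ts)) * after φ (Maybe.map (w ∷_) (runRow h′ ts vs))) ∎

  gridSum-∑ : ∀ {n m} x (α : Vec ℕ n) (φ : Vec ℕ m → Carrier) →
           gridSum x α φ ≈ ∑ (grids n m) (λ D → monomial x (wtNB D) * after φ (runGrid α D))
  gridSum-∑ x [] φ = solve 1 (λ a → a := con 1 :* a :+ con 0) refl _
  gridSum-∑ {suc n} {m} x (a ∷ α) φ = begin
    gridSum (x ∘ suc) α (λ vs → rowSum (x 0) a vs φ) ≈⟨ gridSum-∑ (x ∘ suc) α _ ⟩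
    ∑ (grids n m) (λ D → monomial (x ∘ suc) (wtNB D) * after (λ vs → rowSum (x 0) a vs φ) (runGrid α D))
      ≈⟨ ∑-cong (grids n m) expand ⟩
    ∑ (grids n m) (λ D → ∑ (rows m) (λ ts → monomial x (wtNB (ts ∷ D)) * after φ (runGrid (a ∷ α) (ts ∷ D))))
      ≈⟨ ∑-product (λ D ts → ts ∷ D) (grids n m) (rows m) _ ⟨
    ∑ (grids (suc n) m) (λ D → monomial x (wtNB D) * after φ (runGrid (a ∷ α) D)) ∎
    where
    expand : ∀ D → monomial (x ∘ suc) (wtNB D) * after (λ vs → rowSum (x 0) a vs φ) (runGrid α D) ≈
                   ∑ (rows m) (λ ts → monomial x (wtNB (ts ∷ D)) * after φ (runGrid (a ∷ α) (ts ∷ D)))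
    expand D with runGrid α D
    ... | nothing = trans (zeroʳ _) (sym (trans (∑-cong (rows m) (λ ts → zeroʳ _)) (∑-0 (rows m))))
    ... | just vs = begin
      monomial (x ∘ suc) (wtNB D) * rowSum (x 0) a vs φ ≈⟨ *-congˡ (rowSum-∑ (x 0) a vs φ) ⟩
      monomial (x ∘ suc) (wtNB D) * ∑ (rows m) (λ ts → pow (x 0) (rowCount ts) * after φ (runRow a ts vs))
        ≈⟨ ∑-* (rows m) _ _ ⟨
      ∑ (rows m) (λ ts → monomial (x ∘ suc) (wtNB D) * (pow (x 0) (rowCount ts) * after φ (runRow a ts vs)))
        ≈⟨ ∑-cong (rows m) (λ ts → *-assoc _ _ _) ⟨
      ∑ (rows m) (λ ts → monomial x (wtNB (ts ∷ D)) * after φ (runRow a ts vs)) ∎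

  -- The single pipe dream of a partition.

  δ : ∀ {m} → Vec ℕ m → Vec ℕ m → Carrier
  δ []       []       = 1#
  δ (u ∷ us) (w ∷ ws) = if u ≡ᵇ w then δ us ws else 0#

  δ-head-≢ : ∀ {m u w} (us ws : Vec ℕ m) → u ≡.≢ w → δ (u ∷ us) (w ∷ ws) ≈ 0#
  δ-head-≢ {u = u} {w} us ws ne with u ≡ᵇ w in e
  ... | true  = contradiction (ℕₚ.≡ᵇ⇒≡ u w (≡.subst T (≡.sym e) _)) ne
  ... | false = refl

  δ-refl : ∀ {m} (us : Vec ℕ m) → δ us us ≈ 1#
  δ-refl []       = refl
  δ-refl (u ∷ us) rewrite ≡ᵇ-refl u = δ-refl us

  both-vanish : ∀ x y {a b} → a ≈ 0# → b ≈ 0# → x * a + y * b ≈ 0#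
  both-vanish x y p q = trans (+-cong (trans (*-congˡ p) (zeroʳ x)) (trans (*-congˡ q) (zeroʳ y))) (+-identityˡ 0#)

  -- The label carried along has to leave through a top edge, but all of them are required to be 0.
  rowSum-suc-δ0 : ∀ x h {m} (vs : Vec ℕ m) → rowSum x (suc h) vs (δ (replicate m 0)) ≈ 0#
  rowSum-suc-δ0 x h []           = refl
  rowSum-suc-δ0 x h (zero ∷ vs)  = both-vanish x x (rowSum-suc-δ0 x h vs) (rowSum-0 x 0 vs _ (λ _ → refl))
  rowSum-suc-δ0 x h (suc v ∷ vs) with v <ᵇ h
  ... | true  = trans (*-congˡ (rowSum-0 x (suc h) vs _ (λ _ → refl))) (zeroʳ x)
  ... | false = refl

  -- A nonzero bottom label would have to reappear on top, so only the blank row remains, with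
  -- weight 1.
  rowSum-0-δ0 : ∀ x {m} (vs : Vec ℕ m) → rowSum x 0 vs (δ (replicate m 0)) ≈ δ (replicate m 0) vs
  rowSum-0-δ0 x []           = refl
  rowSum-0-δ0 x (zero ∷ vs)  = rowSum-0-δ0 x vs
  rowSum-0-δ0 x (suc v ∷ vs) = both-vanish x x (rowSum-0 x 0 vs _ (λ _ → refl)) (rowSum-suc-δ0 x v vs)

  -- The prescribed top label `u` is smaller than the travelling label, which therefore cannot rise
  -- here. The tile is horizontal or a crossing, hence the factor `x`, and the bottom label must be
  -- `u`.
  rowSum-pass : ∀ x a k {m} (vs : Vec ℕ m) u v us us′ → u ℕ.< suc a → rowSum x (suc a) vs (δ us) ≈ k * δ us′ vs →
            rowSum x (suc a) (v ∷ vs) (δ (u ∷ us)) ≈ (x * k) * δ (u ∷ us′) (v ∷ vs)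
  rowSum-pass x a k vs u zero us us′ u<a e = begin
    x * rowSum x (suc a) vs (δ (u ∷ us) ∘ (0 ∷_)) + x * rowSum x 0 vs (δ (u ∷ us) ∘ (suc a ∷_))
      ≈⟨ +-cong (*-congˡ (first u)) (trans (*-congˡ (rowSum-0 x 0 vs _ (λ ws → δ-head-≢ us ws (ℕₚ.<⇒≢ u<a)))) (zeroʳ x)) ⟩
    x * (k * δ (u ∷ us′) (0 ∷ vs)) + 0#  ≈⟨ trans (+-identityʳ _) (sym (*-assoc _ _ _)) ⟩
    (x * k) * δ (u ∷ us′) (0 ∷ vs) ∎
    where
    first : ∀ u → rowSum x (suc a) vs (δ (u ∷ us) ∘ (0 ∷_)) ≈ k * δ (u ∷ us′) (0 ∷ vs)
    first zero    = e
    first (suc u) = trans (rowSum-0 x (suc a) vs _ (λ _ → refl)) (sym (zeroʳ k))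
  rowSum-pass x a k vs u (suc v) us us′ u<a e with u ℕ.≟ suc v
  ... | yes ≡.refl rewrite ≡ᵇ-refl v = begin
    (if v <ᵇ a then x * rowSum x (suc a) vs (δ us) else 0#) ≈⟨ if-κ v a _ ⟩
    κ v a * (x * rowSum x (suc a) vs (δ us)) ≈⟨ trans (*-congʳ (κ-< (ℕ.s≤s⁻¹ u<a))) (*-identityˡ _) ⟩
    x * rowSum x (suc a) vs (δ us) ≈⟨ trans (*-congˡ e) (sym (*-assoc _ _ _)) ⟩
    (x * k) * δ us′ vs ∎
  ... | no ne = begin
    (if v <ᵇ a then x * rowSum x (suc a) vs (δ (u ∷ us) ∘ (suc v ∷_)) else 0#) ≈⟨ if-κ v a _ ⟩
    κ v a * (x * rowSum x (suc a) vs (δ (u ∷ us) ∘ (suc v ∷_)))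
      ≈⟨ *-congˡ (*-congˡ (rowSum-0 x (suc a) vs _ (λ ws → δ-head-≢ us ws ne))) ⟩
    κ v a * (x * 0#) ≈⟨ trans (*-congˡ (zeroʳ x)) (zeroʳ _) ⟩
    0# ≈⟨ trans (*-congˡ (δ-head-≢ us′ vs ne)) (zeroʳ _) ⟨
    (x * k) * δ (u ∷ us′) (suc v ∷ vs) ∎

  -- The largest label passes the `d` columns before its own and rises there, giving `suc d`
  -- non-blank tiles. The columns further right are empty, and the bottom labels are the top labels
  -- with this pipe removed.
  rowSum-largest : ∀ x j d a {n m} (α : Vec ℕ n) (vs : Vec ℕ m) → a ≡ j ℕ.+ d → d ℕ.< m → (∀ i → at α i ℕ.< suc a) →
               rowSum x (suc a) vs (δ (topLabels j m (suc a ∷ α))) ≈ pow x (suc d) * δ (topLabels j m α) vs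
  rowSum-largest x j zero a {m = suc m} α (v ∷ vs) e lt <a
    rewrite ℕₚ.+-identityʳ j with ≡.refl ← e
    rewrite ι-refl j | topLabels-zero m (suc j) (suc j ∷ α) (λ { zero → ℕₚ.≤-refl ; (suc i) → ℕₚ.<⇒≤ (<a i) })
          | occurrences-≢ (suc j) α (λ i _ → ℕₚ.<⇒≢ (<a i)) | topLabels-zero m (suc j) α (λ i → ℕₚ.<⇒≤ (<a i)) = last v
    where
    last : ∀ v → rowSum x (suc j) (v ∷ vs) (δ (suc j ∷ replicate m 0)) ≈ (x * 1#) * δ (0 ∷ replicate m 0) (v ∷ vs)
    last zero rewrite ≡ᵇ-refl j = begin
      x * rowSum x (suc j) vs (λ _ → 0#) + x * rowSum x 0 vs (δ (replicate m 0))
        ≈⟨ +-cong (trans (*-congˡ (rowSum-0 x (suc j) vs _ (λ _ → refl))) (zeroʳ x)) (*-congˡ (rowSum-0-δ0 x vs)) ⟩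
      0# + x * δ (replicate m 0) vs ≈⟨ trans (+-identityˡ _) (*-congʳ (sym (*-identityʳ x))) ⟩
      (x * 1#) * δ (replicate m 0) vs ∎
    -- An occupied bottom edge forces a crossing, which either violates the rule or puts a label
    -- other than `suc j` on top.
    last (suc v) with v ℕ.<? j
    ... | yes v<j = begin
      (if v <ᵇ j then x * rowSum x (suc j) vs (δ (suc j ∷ replicate m 0) ∘ (suc v ∷_)) else 0#) ≈⟨ if-κ v j _ ⟩
      κ v j * (x * rowSum x (suc j) vs (δ (suc j ∷ replicate m 0) ∘ (suc v ∷_)))
        ≈⟨ *-congˡ (*-congˡ (rowSum-0 x (suc j) vs _ (λ ws → δ-head-≢ (replicate m 0) ws (ℕₚ.<⇒≢ (s≤s v<j) ∘ ≡.sym)))) ⟩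
      κ v j * (x * 0#) ≈⟨ trans (*-congˡ (zeroʳ x)) (zeroʳ _) ⟩
      0# ≈⟨ zeroʳ _ ⟨
      (x * 1#) * 0# ∎
    ... | no v≮j = trans (if-κ v j _) (trans (trans (*-congʳ (κ-≥ (ℕₚ.≮⇒≥ v≮j))) (zeroˡ _)) (sym (zeroʳ _)))
  rowSum-largest x j (suc d) a {m = suc m} α (v ∷ vs) e (s≤s lt) <a
    rewrite ι-≢ {j} {a} (λ j≡a → ℕₚ.m≢1+m+n j (≡.trans (≡.trans j≡a e) (ℕₚ.+-suc j d))) =
    rowSum-pass x a (pow x (suc d)) vs _ v _ (topLabels (suc j) m α) (head< (occurrences (suc j) α))
      (rowSum-largest x (suc j) d a α vs (≡.trans e (ℕₚ.+-suc j d)) lt <a)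
    where
    head< : ∀ k → (if isPos k then suc j else 0) ℕ.< suc a
    head< zero    = z<s
    head< (suc _) = s≤s (≡.subst (j ℕ.<_) (≡.sym (≡.trans e (ℕₚ.+-suc j d))) (s≤s (ℕₚ.m≤m+n j d)))

  partition-≤ : ∀ {n a} {α : Vec ℕ n} → IsPartition (a ∷ α) → ∀ i → at α i ℕ.≤ a
  partition-≤ p zero    = p 0
  partition-≤ p (suc i) = ℕₚ.≤-trans (p (suc i)) (partition-≤ p i)

  -- The pipe of the first row has the largest label, so it runs straight to its column and turns
  -- up, while all others pass it vertically. The row gives a power of its variable and leaves the
  -- same problem for the tail.
  gridSum-partition : ∀ {n m} x (α : Vec ℕ n) → Snowy α → IsPartition α → (∀ i → at α i ℕ.≤ m) →
                   gridSum x α (δ (topLabels 0 m α)) ≈ monomial x α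
  gridSum-partition {m = m} x [] s p le rewrite topLabels-zero m 0 [] (λ _ → z≤n) = δ-refl (replicate m 0)
  gridSum-partition {m = m} x (zero ∷ α) s p le = begin
    gridSum (x ∘ suc) α (λ vs → rowSum (x 0) 0 vs (δ (topLabels 0 m (0 ∷ α))))
      ≈⟨ gridSum-cong (x ∘ suc) α row ⟩
    gridSum (x ∘ suc) α (δ (topLabels 0 m α)) ≈⟨ gridSum-partition (x ∘ suc) α (snowy-tail s) (p ∘ suc) (le ∘ suc) ⟩
    monomial (x ∘ suc) α ≈⟨ *-identityʳ _ ⟨
    monomial (x ∘ suc) α * 1# ∎
    where
    row : ∀ vs → rowSum (x 0) 0 vs (δ (topLabels 0 m (0 ∷ α))) ≈ δ (topLabels 0 m α) vs
    row vs rewrite topLabels-zero m 0 (0 ∷ α) (λ { zero → z≤n ; (suc i) → partition-≤ p i })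
                 | topLabels-zero m 0 α (partition-≤ p) = rowSum-0-δ0 (x 0) vs
  gridSum-partition {m = m} x (suc a ∷ α) s p le = begin
    gridSum (x ∘ suc) α (λ vs → rowSum (x 0) (suc a) vs (δ (topLabels 0 m (suc a ∷ α))))
      ≈⟨ gridSum-cong (x ∘ suc) α (λ vs → rowSum-largest (x 0) 0 a a α vs ≡.refl (le 0) below) ⟩
    gridSum (x ∘ suc) α (λ vs → pow (x 0) (suc a) * δ (topLabels 0 m α) vs) ≈⟨ gridSum-* (x ∘ suc) α _ _ ⟩
    pow (x 0) (suc a) * gridSum (x ∘ suc) α (δ (topLabels 0 m α))
      ≈⟨ *-congˡ (gridSum-partition (x ∘ suc) α (snowy-tail s) (p ∘ suc) (le ∘ suc)) ⟩
    pow (x 0) (suc a) * monomial (x ∘ suc) α ≈⟨ *-comm _ _ ⟩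
    monomial (x ∘ suc) α * pow (x 0) (suc a) ∎
    where
    -- Snowiness makes the weak inequalities of a partition strict below a positive entry.
    below : ∀ i → at α i ℕ.< suc a
    below i = ℕₚ.≤∧≢⇒< (partition-≤ p i) (λ e → s 0 (suc i) (λ ()) z<s (≡.sym e))

open import Data.Integer using () renaming (_+_ to _+ℤ_; _-_ to _-ℤ_)
import Data.Integer as ℤ
import Data.Integer.Properties as ℤₚ
open import Data.Integer.Solver using (module +-*-Solver)
open import Data.List using (filter)
open import Data.List.Membership.Propositional.Properties using (∈-cartesianProductWith⁺; ∈-filter⁺; ∈-filter⁻)
open import Data.List.Membership.Propositional.Properties.WithK using (unique∧set⇒bag)
open import Data.List.Relation.Binary.BagAndSetEquality using (∼bag⇒↭)
open import Data.List.Relation.Binary.Permutation.Propositional using (_↭_; refl; prep; swap; trans)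
open import Data.List.Relation.Unary.All using ([]; _∷_)
open import Data.List.Relation.Unary.AllPairs using ([]; _∷_)
open import Data.List.Relation.Unary.Any using (here; there)
open import Data.List.Relation.Unary.Unique.Propositional.Properties using (cartesianProductWith⁺; filter⁺)
import Data.Maybe.Properties as Maybeₚ
open import Data.Nat using (_+_; _≤_; _<_)
open import Data.Nat.Properties
open import Data.Vec using (sum)
open import Data.Vec.Properties using (≡-dec; ∷-injective)
open import Function.Bundles using (mk⇔; Equivalence)
open import Relation.Binary.PropositionalEquality as ≡ using (_≡_; _≢_; refl; sym; cong; cong₂; subst)
open Labelling
open Tracing
open Series

-- The pipe dreams as a finite list without repetitions.

rows-complete : ∀ {m} (ts : Vec Tile m) → ts ∈ rows m
rows-complete []       = here refl
rows-complete (t ∷ ts) = ∈-cartesianProductWith⁺ _∷_ (tile-∈ t) (rows-complete ts)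
  where
  tile-∈ : ∀ t → t ∈ tiles
  tile-∈ blank   = here refl
  tile-∈ vert    = there (here refl)
  tile-∈ elbowBR = there (there (here refl))
  tile-∈ horiz   = there (there (there (here refl)))
  tile-∈ elbowLT = there (there (there (there (here refl))))
  tile-∈ cross   = there (there (there (there (there (here refl)))))

grids-complete : ∀ {n m} (D : Grid n m) → D ∈ grids n m
grids-complete []       = here refl
grids-complete (ts ∷ D) = ∈-cartesianProductWith⁺ (λ D ts → ts ∷ D) (grids-complete D) (rows-complete ts)

rows-unique : ∀ m → Unique (rows m)
rows-unique zero    = [] ∷ []
rows-unique (suc m) = cartesianProductWith⁺ _∷_ ∷-injective tiles-unique (rows-unique m)
  where
  tiles-unique : Unique tiles
  tiles-unique = ((λ ()) ∷ (λ ()) ∷ (λ ()) ∷ (λ ()) ∷ (λ ()) ∷ []) ∷ ((λ ()) ∷ (λ ()) ∷ (λ ()) ∷ (λ ()) ∷ []) ∷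
    ((λ ()) ∷ (λ ()) ∷ (λ ()) ∷ []) ∷ ((λ ()) ∷ (λ ()) ∷ []) ∷ ((λ ()) ∷ []) ∷ [] ∷ []

grids-unique : ∀ n m → Unique (grids n m)
grids-unique zero    m = [] ∷ []
grids-unique (suc n) m = cartesianProductWith⁺ (λ D ts → ts ∷ D)
  (λ e → proj₂ (∷-injective e) , proj₁ (∷-injective e)) (grids-unique n m) (rows-unique m)

row⇒run : ∀ {h m} {ts : Vec Tile m} {vs ws} → Row _<_ h ts vs ws → runRow h ts vs ≡ just ws
row⇒run [] = refl
row⇒run (blank ∷ R) rewrite row⇒run R = refl
row⇒run (vert ∷ R)  rewrite row⇒run R = refl
row⇒run (bend ∷ R)  rewrite row⇒run R = refl
row⇒run (horiz ∷ R) rewrite row⇒run R = refl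
row⇒run (rise ∷ R)  rewrite row⇒run R = refl
row⇒run (cross {h} {v} (s≤s lt) ∷ R) with v <ᵇ h | <⇒<ᵇ lt
... | true | _ rewrite row⇒run R = refl

step⇒local : ∀ h t v {h′ w} → tileStep h t v ≡ just (h′ , w) → Local _<_ h t v h′ w
step⇒local zero    blank   zero    refl = blank
step⇒local zero    vert    (suc v) refl = vert
step⇒local zero    elbowBR (suc v) refl = bend
step⇒local (suc h) horiz   zero    refl = horiz
step⇒local (suc h) elbowLT zero    refl = rise
step⇒local (suc h) cross   (suc v) e with v <ᵇ h in lt | e
... | true | refl = cross (s≤s (<ᵇ⇒< v h (subst T (sym lt) _)))

run⇒row : ∀ h {m} (ts : Vec Tile m) vs {ws} → runRow h ts vs ≡ just ws → Row _<_ h ts vs ws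
run⇒row zero    [] [] refl = []
run⇒row (suc h) [] [] ()
run⇒row h (t ∷ ts) (v ∷ vs) e with tileStep h t v in eq
... | just (h′ , w) with runRow h′ ts vs in eq′ | e
...   | just ws | refl = step⇒local h t v eq ∷ run⇒row h′ ts vs eq′

lab⇒run : ∀ {n m} {α : Vec ℕ n} {D : Grid n m} {ws} → Lab _<_ α D ws → runGrid α D ≡ just ws
lab⇒run []      = refl
lab⇒run (R ∷ G) rewrite lab⇒run G = row⇒run R

run⇒lab : ∀ {n m} (α : Vec ℕ n) (D : Grid n m) {ws} → runGrid α D ≡ just ws → Lab _<_ α D ws
run⇒lab []      []       refl = []
run⇒lab (a ∷ α) (ts ∷ D) e with runGrid α D in eq
... | just vs = run⇒row a ts vs e ∷ run⇒lab α D eq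

runs? : ∀ {n m} (α : Vec ℕ n) (D : Grid n m) → Dec (runGrid α D ≡ just (topLabels 0 m α))
runs? α D = Maybeₚ.≡-dec (≡-dec _≟_) _ _

pipeDreams : ∀ {n} m → Vec ℕ n → List (Grid n m)
pipeDreams {n} m α = filter (runs? α) (grids n m)

-- Constructing the divided difference on coefficients.

incAt : ∀ {n} → ℕ → Vec ℕ n → Vec ℕ n
incAt i       []      = []
incAt zero    (x ∷ γ) = suc x ∷ γ
incAt (suc i) (x ∷ γ) = x ∷ incAt i γ

at-incAt : ∀ {n} i (γ : Vec ℕ n) → i < n → at (incAt i γ) i ≡ suc (at γ i)
at-incAt zero    (x ∷ γ) _        = refl
at-incAt (suc i) (x ∷ γ) (s≤s lt) = at-incAt i γ lt

at-incAt-≢ : ∀ {n} i j (γ : Vec ℕ n) → i ≢ j → at (incAt i γ) j ≡ at γ j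
at-incAt-≢ i       j       []      ne = refl
at-incAt-≢ zero    zero    (x ∷ γ) ne = contradiction refl ne
at-incAt-≢ zero    (suc j) (x ∷ γ) ne = refl
at-incAt-≢ (suc i) zero    (x ∷ γ) ne = refl
at-incAt-≢ (suc i) (suc j) (x ∷ γ) ne = at-incAt-≢ i j γ (ne ∘ cong suc)

decAt-incAt : ∀ {n} i (γ : Vec ℕ n) → decAt i (incAt i γ) ≡ γ
decAt-incAt i       []      = refl
decAt-incAt zero    (x ∷ γ) = refl
decAt-incAt (suc i) (x ∷ γ) = cong (x ∷_) (decAt-incAt i γ)

incAt-decAt : ∀ {n} i (γ : Vec ℕ n) {k} → at γ i ≡ suc k → incAt i (decAt i γ) ≡ γ
incAt-decAt zero    (suc x ∷ γ) _ = refl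
incAt-decAt (suc i) (x ∷ γ)     e = cong (x ∷_) (incAt-decAt i γ e)

incAt-comm : ∀ {n} i j (γ : Vec ℕ n) → incAt i (incAt j γ) ≡ incAt j (incAt i γ)
incAt-comm i       j       []      = refl
incAt-comm zero    zero    (x ∷ γ) = refl
incAt-comm zero    (suc j) (x ∷ γ) = refl
incAt-comm (suc i) zero    (x ∷ γ) = refl
incAt-comm (suc i) (suc j) (x ∷ γ) = cong (x ∷_) (incAt-comm i j γ)

mulVar-incAt : ∀ {n} i (f : Poly n) γ → i < n → mulVar i f (incAt i γ) ≡ f γ
mulVar-incAt i f γ lt = ≡.trans (mulVar-suc i f (incAt i γ) (at-incAt i γ lt)) (cong f (decAt-incAt i γ))

-- The coefficient of eq at an exponent divisible by exactly one of x_i and x_{i+1} shows that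
-- f is divisible by both.
module Divide {n : ℕ} (i : ℕ) (lt : suc i < n) (f g : Poly n)
  (eq : ∀ γ → mulVar i (mulVar (suc i) g) γ +ℤ mulVar (suc i) f γ ≡
              mulVar i (mulVar (suc i) (swapP i g)) γ +ℤ mulVar i f γ) where

  i′ = suc i

  i<n : i < n
  i<n = <⇒≤ lt

  f-i : ∀ γ → at γ i ≡ 0 → f γ ≡ ℤ.0ℤ
  f-i γ e = begin
    f γ                                                 ≡⟨ ℤₚ.+-identityˡ _ ⟨
    ℤ.0ℤ +ℤ f γ                                         ≡⟨ cong₂ _+ℤ_ (mulVar-0 i _ γ′ e′) (mulVar-incAt i′ f γ lt) ⟨
    mulVar i (mulVar i′ g) γ′ +ℤ mulVar i′ f γ′         ≡⟨ eq γ′ ⟩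
    mulVar i (mulVar i′ (swapP i g)) γ′ +ℤ mulVar i f γ′ ≡⟨ cong₂ _+ℤ_ (mulVar-0 i _ γ′ e′) (mulVar-0 i f γ′ e′) ⟩
    ℤ.0ℤ ∎
    where
    open ≡.≡-Reasoning
    γ′ = incAt i′ γ
    e′ : at γ′ i ≡ 0
    e′ = ≡.trans (at-incAt-≢ i′ i γ 1+n≢n) e

  f-i′ : ∀ γ → at γ i′ ≡ 0 → f γ ≡ ℤ.0ℤ
  f-i′ γ e = begin
    f γ                                                 ≡⟨ ℤₚ.+-identityˡ _ ⟨
    ℤ.0ℤ +ℤ f γ
      ≡⟨ cong₂ _+ℤ_ (≡.trans (mulVar-incAt i (mulVar i′ (swapP i g)) γ i<n) (mulVar-0 i′ (swapP i g) γ e)) (mulVar-incAt i f γ i<n) ⟨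
    mulVar i (mulVar i′ (swapP i g)) γ′ +ℤ mulVar i f γ′ ≡⟨ eq γ′ ⟨
    mulVar i (mulVar i′ g) γ′ +ℤ mulVar i′ f γ′
      ≡⟨ cong₂ _+ℤ_ (≡.trans (mulVar-incAt i (mulVar i′ g) γ i<n) (mulVar-0 i′ g γ e)) (mulVar-0 i′ f γ′ e′) ⟩
    ℤ.0ℤ ∎
    where
    open ≡.≡-Reasoning
    γ′ = incAt i γ
    e′ : at γ′ i′ ≡ 0
    e′ = ≡.trans (at-incAt-≢ i i′ γ (1+n≢n ∘ sym)) e

  -- Coefficientwise, this is `f` divided by both variables.
  h : Poly n
  h γ = f (incAt i (incAt i′ γ))

  f≈h : f ≈P mulVar i (mulVar i′ h)
  f≈h γ with at γ i in e
  ... | zero = f-i γ e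
  ... | suc _ with at γ i′ in e′
  ...   | zero = ≡.trans (f-i′ γ e′) (sym (mulVar-0 i′ h (decAt i γ) (≡.trans (at-decAt i i′ γ (1+n≢n ∘ sym)) e′)))
  ...   | suc _ = sym (≡.trans (mulVar-suc i′ h (decAt i γ) e″) (cong f (≡.trans
            (cong (incAt i) (incAt-decAt i′ (decAt i γ) e″)) (incAt-decAt i γ e))))
    where e″ = ≡.trans (at-decAt i i′ γ (1+n≢n ∘ sym)) e′

  -- One factor cancels, leaving `f` divided by the other variable; at exponents without the
  -- variable `i` both sides vanish by `f-i`.
  xh : ∀ γ → mulVar i h γ ≡ f (incAt i′ γ)
  xh γ with at γ i in e
  ... | zero  = sym (f-i _ (≡.trans (at-incAt-≢ i′ i γ 1+n≢n) e))
  ... | suc _ = cong f (≡.trans (incAt-comm i i′ _) (cong (incAt i′) (incAt-decAt i γ e)))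

  yh : ∀ γ → mulVar i′ h γ ≡ f (incAt i γ)
  yh γ with at γ i′ in e
  ... | zero  = sym (f-i′ _ (≡.trans (at-incAt-≢ i i′ γ (1+n≢n ∘ sym)) e))
  ... | suc _ = cong f (cong (incAt i) (incAt-decAt i′ γ e))

  cross-diff : ∀ {a b c d} → a +ℤ b ≡ c +ℤ d → d -ℤ b ≡ a -ℤ c
  cross-diff {a} {b} {c} {d} e = begin
    d -ℤ b                            ≡⟨ cong (_-ℤ b) (ℤₚ.+-identityʳ d) ⟨
    (d +ℤ ℤ.0ℤ) -ℤ b                  ≡⟨ cong (λ z → (d +ℤ z) -ℤ b) (ℤₚ.+-inverseʳ c) ⟨
    (d +ℤ (c -ℤ c)) -ℤ b              ≡⟨ solve 3 (λ b c d → (d :+ (c :- c)) :- b := (c :+ d) :- b :- c) refl b c d ⟩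
    (c +ℤ d) -ℤ b -ℤ c                ≡⟨ cong (λ z → z -ℤ b -ℤ c) e ⟨
    (a +ℤ b) -ℤ b -ℤ c                ≡⟨ solve 3 (λ a b c → (a :+ b) :- b :- c := a :- c) refl a b c ⟩
    a -ℤ c                            ∎
    where
    open ≡.≡-Reasoning
    open +-*-Solver

  -- `eq` is read at `γ` with both exponents raised by 1, where the products with both variables
  -- reduce to the coefficients of `g` and `swapP i g` at `γ`.
  isDivDiff : IsDivDiff i g h
  isDivDiff γ rewrite xh γ | yh γ = cross-diff {g γ} {f (incAt i γ)} {swapP i g γ} {f (incAt i′ γ)} (begin
    g γ +ℤ f (incAt i γ)
      ≡⟨ cong₂ _+ℤ_ (top g) (≡.trans (cong (mulVar i′ f) (incAt-comm i i′ γ)) (mulVar-incAt i′ f _ lt)) ⟨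
    mulVar i (mulVar i′ g) γ′ +ℤ mulVar i′ f γ′             ≡⟨ eq γ′ ⟩
    mulVar i (mulVar i′ (swapP i g)) γ′ +ℤ mulVar i f γ′
      ≡⟨ cong₂ _+ℤ_ (top (swapP i g)) (mulVar-incAt i f _ i<n) ⟩
    swapP i g γ +ℤ f (incAt i′ γ) ∎)
    where
    open ≡.≡-Reasoning
    γ′ = incAt i (incAt i′ γ)
    top : ∀ k → mulVar i (mulVar i′ k) γ′ ≡ k γ
    top k = ≡.trans (mulVar-incAt i (mulVar i′ k) (incAt i′ γ) i<n) (mulVar-incAt i′ k γ lt)

-- Monomials, and the effect of swapping adjacent entries.

monoP-≡ : ∀ {n} (β : Vec ℕ n) → monoP β β ≡ ℤ.1ℤ
monoP-≡ β with ≡-dec _≟_ β β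
... | yes _ = refl
... | no ne = contradiction refl ne

monoP-≢ : ∀ {n} {β γ : Vec ℕ n} → γ ≢ β → monoP β γ ≡ ℤ.0ℤ
monoP-≢ {β = β} {γ} ne with ≡-dec _≟_ γ β
... | yes e = contradiction e ne
... | no _  = refl

monoP-⇔ : ∀ {m n} {β γ : Vec ℕ m} {β′ γ′ : Vec ℕ n} →
          (γ ≡ β → γ′ ≡ β′) → (γ′ ≡ β′ → γ ≡ β) → monoP β γ ≡ monoP β′ γ′
monoP-⇔ {β = β} {γ} {β′} {γ′} to from with ≡-dec _≟_ γ β
... | yes e = sym (≡.trans (cong (monoP β′) (to e)) (monoP-≡ β′))
... | no ne = sym (monoP-≢ (ne ∘ from))

mulVar-monoP : ∀ {n} i (β : Vec ℕ n) → i < n → mulVar i (monoP β) ≈P monoP (incAt i β)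
mulVar-monoP i β lt γ with at γ i in e
... | zero  = sym (monoP-≢ {β = incAt i β} {γ} (λ { refl → contradiction (≡.trans (sym (at-incAt i β lt)) e) (λ ()) }))
... | suc _ = monoP-⇔ {β = β} {decAt i γ} {incAt i β} {γ} (λ { refl → sym (incAt-decAt i γ e) }) (λ { refl → decAt-incAt i β })

swapV-invol : ∀ {A : Set} {n} i (γ : Vec A n) → swapV i (swapV i γ) ≡ γ
swapV-invol zero    []          = refl
swapV-invol zero    (x ∷ [])    = refl
swapV-invol zero    (x ∷ y ∷ γ) = refl
swapV-invol (suc i) []          = refl
swapV-invol (suc i) (x ∷ γ)     = cong (x ∷_) (swapV-invol i γ)

swapV-replicate : ∀ {A : Set} i n (x : A) → swapV i (replicate n x) ≡ replicate n x
swapV-replicate zero    zero          x = refl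
swapV-replicate zero    (suc zero)    x = refl
swapV-replicate zero    (suc (suc n)) x = refl
swapV-replicate (suc i) zero          x = refl
swapV-replicate (suc i) (suc n)       x = cong (x ∷_) (swapV-replicate i n x)

one : ∀ {n} → Poly n
one {n} = monoP (replicate n 0)

swapP-one : ∀ {n} i → swapP i (one {n}) ≈P one
swapP-one {n} i γ = monoP-⇔ {β = replicate n 0} {swapV i γ} {replicate n 0} {γ}
  (λ e → ≡.trans (sym (swapV-invol i γ)) (≡.trans (cong (swapV i) e) (swapV-replicate i n 0)))
  (λ { refl → swapV-replicate i n 0 })

occurrences-swapV : ∀ a {k} i (α : Vec ℕ k) → occurrences a (swapV i α) ≡ occurrences a α
occurrences-swapV a zero    []          = refl
occurrences-swapV a zero    (x ∷ [])    = refl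
occurrences-swapV a zero    (x ∷ y ∷ α) = ≡.trans (sym (+-assoc (ι a y) _ _))
  (≡.trans (cong (_+ occurrences a α) (+-comm (ι a y) (ι a x))) (+-assoc (ι a x) _ _))
occurrences-swapV a (suc i) []          = refl
occurrences-swapV a (suc i) (x ∷ α)     = cong (ι a x +_) (occurrences-swapV a i α)

topLabels-swapV : ∀ j m {k} i (α : Vec ℕ k) → topLabels j m (swapV i α) ≡ topLabels j m α
topLabels-swapV j zero    i α = refl
topLabels-swapV j (suc m) i α rewrite occurrences-swapV (suc j) i α = cong (_ ∷_) (topLabels-swapV (suc j) m i α)

-- Σ i α_i, which decreases when an ascent is swapped.
weight : ∀ {k} → Vec ℕ k → ℕ
weight []      = 0
weight (a ∷ α) = sum α + weight α

sum-swapV : ∀ {k} i (α : Vec ℕ k) → sum (swapV i α) ≡ sum α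
sum-swapV zero    []          = refl
sum-swapV zero    (x ∷ [])    = refl
sum-swapV zero    (x ∷ y ∷ α) = ≡.trans (sym (+-assoc y x _)) (≡.trans (cong (_+ sum α) (+-comm y x)) (+-assoc x y _))
sum-swapV (suc i) []          = refl
sum-swapV (suc i) (x ∷ α)     = cong (x +_) (sum-swapV i α)

weight-swapV : ∀ {k} i (α : Vec ℕ k) → at α i < at α (suc i) → weight (swapV i α) < weight α
weight-swapV zero    (x ∷ y ∷ α) lt = +-monoˡ-< (sum α + weight α) (+-monoˡ-< (sum α) lt)
weight-swapV (suc i) (x ∷ α)     lt rewrite sum-swapV i α = +-monoʳ-< (sum α) (weight-swapV i α lt)

ascent : ∀ {k} (α : Vec ℕ k) → IsPartition α ⊎ ∃ λ i → at α i < at α (suc i)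
ascent []      = inj₁ (λ i → z≤n)
ascent (a ∷ α) with <-≤-connex a (at α 0) | ascent α
... | inj₁ lt | _            = inj₂ (0 , lt)
... | inj₂ _  | inj₂ (i , p) = inj₂ (suc i , p)
... | inj₂ le | inj₁ p       = inj₁ λ { zero → le ; (suc i) → p i }

swapN-injective : ∀ i {j k} → swapN i j ≡ swapN i k → j ≡ k
swapN-injective i {j} {k} e = ≡.trans (sym (invol i j)) (≡.trans (cong (swapN i) e) (invol i k))
  where
  invol : ∀ i j → swapN i (swapN i j) ≡ j
  invol zero    zero          = refl
  invol zero    (suc zero)    = refl
  invol zero    (suc (suc j)) = refl
  invol (suc i) zero          = refl
  invol (suc i) (suc j)       = cong suc (invol i j)

snowy-swapV : ∀ {n} i (α : Vec ℕ n) → suc i < n → Snowy α → Snowy (swapV i α)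
snowy-swapV i α lt s j k ne rewrite at-swapV i j α lt | at-swapV i k α lt = s _ _ (ne ∘ swapN-injective i)

-- The generating function satisfies the recursion.

module _ {n : ℕ} where

  private module S = Transfer (exprSemiring n)
  open S using (rowSum; gridSum; δ; monomial; pow; ∑; after)

  -- The equality is syntactic because `rename` acts on syntax and is not shown to respect equality
  -- of the operators.
  rename-rowSum : ∀ σ x h {m} (vs : Vec ℕ m) {φ ψ} → (∀ ws → rename σ (φ ws) ≡ ψ ws) →
              rename σ (rowSum x h vs φ) ≡ rowSum (rename σ x) h vs ψ
  rename-rowSum σ x zero    []           e = e []
  rename-rowSum σ x (suc h) []           e = refl
  rename-rowSum σ x zero    (zero ∷ vs)  e = rename-rowSum σ x zero vs (e ∘ _)
  rename-rowSum σ x zero    (suc v ∷ vs) e =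
    cong₂ (λ a b → rename σ x ⊗ a ⊕ rename σ x ⊗ b) (rename-rowSum σ x zero vs (e ∘ _)) (rename-rowSum σ x (suc v) vs (e ∘ _))
  rename-rowSum σ x (suc h) (zero ∷ vs)  e =
    cong₂ (λ a b → rename σ x ⊗ a ⊕ rename σ x ⊗ b) (rename-rowSum σ x (suc h) vs (e ∘ _)) (rename-rowSum σ x zero vs (e ∘ _))
  rename-rowSum σ x (suc h) (suc v ∷ vs) e with v <ᵇ h
  ... | true  = cong (rename σ x ⊗_) (rename-rowSum σ x (suc h) vs (e ∘ _))
  ... | false = refl

  rename-gridSum : ∀ σ x {k m} (α : Vec ℕ k) {φ ψ : Vec ℕ m → Expr} → (∀ ws → rename σ (φ ws) ≡ ψ ws) →
                rename σ (gridSum x α φ) ≡ gridSum (rename σ ∘ x) α ψ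
  rename-gridSum σ x []      e = e _
  rename-gridSum σ x (a ∷ α) e = rename-gridSum σ (x ∘ suc) α (λ vs → rename-rowSum σ (x 0) a vs e)

  rename-δ : ∀ σ {m} (us ws : Vec ℕ m) → rename σ (δ us ws) ≡ δ us ws
  rename-δ σ []       []       = refl
  rename-δ σ (u ∷ us) (w ∷ ws) with u ≡ᵇ w
  ... | true  = rename-δ σ us ws
  ... | false = refl

  -- With `m` independent of α, the sums for α and `swapV i α` run over grids of the same width.
  labelSum : ∀ {k} → ℕ → Vec ℕ k → Poly n
  labelSum m α = ⟦ gridSum var α (δ (topLabels 0 m α)) ⟧ one

  ⟦pow⟧ : ∀ {k} i (emb : Vec ℕ (suc k) → Vec ℕ n) γ a →
          (∀ β → mulVar i (monoP (emb β)) ≈P monoP (emb (incAt 0 β))) →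
          ⟦ pow (var i) a ⟧ (monoP (emb (0 ∷ γ))) ≈P monoP (emb (a ∷ γ))
  ⟦pow⟧ i emb γ zero    mul δ = refl
  ⟦pow⟧ i emb γ (suc a) mul δ = ≡.trans (mulVar-cong i (⟦pow⟧ i emb γ a mul) δ) (mul (a ∷ γ) δ)

  -- `x` and `emb` place the remaining variables and exponents among all `n`, so that the exponent
  -- vector can shrink while the power series stay in `n` variables.
  ⟦monomial⟧-emb : ∀ {k} (x : ℕ → ℕ) (emb : Vec ℕ k → Vec ℕ n) →
                   (∀ i β → i < k → mulVar (x i) (monoP (emb β)) ≈P monoP (emb (incAt i β))) →
                   ∀ β → ⟦ monomial (var ∘ x) β ⟧ (monoP (emb (replicate k 0))) ≈P monoP (emb β)
  ⟦monomial⟧-emb x emb mul []      γ = refl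
  ⟦monomial⟧-emb x emb mul (a ∷ β) γ = ≡.trans
    (⟦⟧-cong (monomial (var ∘ x ∘ suc) β) (⟦pow⟧ (x 0) emb _ a (λ β → mul 0 β z<s)) γ)
    (⟦monomial⟧-emb (x ∘ suc) (emb ∘ (a ∷_)) (λ i β lt → mul (suc i) (a ∷ β) (s≤s lt)) β γ)

  ⟦monomial⟧ : ∀ (β : Vec ℕ n) → ⟦ monomial var β ⟧ one ≈P monoP β
  ⟦monomial⟧ = ⟦monomial⟧-emb (λ i → i) (λ β → β) (λ i β → mulVar-monoP i β)

  δ-≢ : ∀ {m} (us ws : Vec ℕ m) → us ≢ ws → ∀ f → ⟦ δ us ws ⟧ f ≈P zeroP {n}
  δ-≢ []       []       ne = contradiction refl ne
  δ-≢ (u ∷ us) (w ∷ ws) ne with u ≡ᵇ w in e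
  ... | true  = δ-≢ us ws (λ e′ → ne (cong₂ _∷_ (≡ᵇ⇒≡ u w (subst T (sym e) _)) e′))
  ... | false = λ f γ → refl

  -- `δ` acts as 1 on the grids with the required top labels; all others contribute 0 and are the
  -- ones that `filter` removes.
  ∑-sumMonos : ∀ {m} (α : Vec ℕ n) (Ds : List (Grid n m)) →
    ⟦ ∑ Ds (λ D → monomial var (wtNB D) ⊗ after (δ (topLabels 0 m α)) (runGrid α D)) ⟧ one ≈P
    sumMonos (map wtNB (filter (runs? α) Ds))
  ∑-sumMonos α []       γ = refl
  ∑-sumMonos {m} α (D ∷ Ds) γ with runs? α D
  ... | yes e = cong₂ _+ℤ_ (≡.trans (⟦⟧-cong (monomial var (wtNB D)) (unit (runGrid α D) e) γ) (⟦monomial⟧ (wtNB D) γ)) (∑-sumMonos α Ds γ)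
    where
    unit : ∀ r → r ≡ just (topLabels 0 m α) → ⟦ after (δ (topLabels 0 m α)) r ⟧ one ≈P one {n}
    unit _ refl = S.δ-refl (topLabels 0 m α) one
  ... | no ne = ≡.trans (cong₂ _+ℤ_ (≡.trans (⟦⟧-cong (monomial var (wtNB D)) (null (runGrid α D) ne) γ)
                  (⟦⟧-zeroP (monomial var (wtNB D)) γ)) (∑-sumMonos α Ds γ)) (ℤₚ.+-identityˡ _)
    where
    null : ∀ r → r ≢ just (topLabels 0 m α) → ⟦ after (δ (topLabels 0 m α)) r ⟧ one ≈P zeroP
    null nothing   ne γ = refl
    null (just ws) ne   = δ-≢ (topLabels 0 m α) ws (λ e → ne (cong just (sym e))) one

  labelSum-sumMonos : ∀ m (α : Vec ℕ n) → labelSum m α ≈P sumMonos (map wtNB (pipeDreams m α))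
  labelSum-sumMonos m α γ = ≡.trans (S.gridSum-∑ var α (δ (topLabels 0 m α)) one γ) (∑-sumMonos α (grids n m) γ)

  -- The exchange of variables in `gridSum-exch` becomes `swapP`, because `one` is symmetric and the
  -- top labels do not depend on the order of the entries.
  labelSum-exch : ∀ m (α : Vec ℕ n) i → at α i < at α (suc i) →
           let f = labelSum m α ; g = labelSum m (swapV i α) in ∀ γ →
           mulVar i (mulVar (suc i) g) γ +ℤ mulVar (suc i) f γ ≡
           mulVar i (mulVar (suc i) (swapP i g)) γ +ℤ mulVar i f γ
  labelSum-exch m α i a<b γ rewrite topLabels-swapV 0 m i α = ≡.trans (S.gridSum-exch var α i (δ (topLabels 0 m α)) a<b one γ)
    (cong (_+ℤ mulVar i (labelSum m α) γ) (mulVar-cong i (mulVar-cong (suc i) (λ γ → sym (swapped γ))) γ))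
    where
    i′<n : suc i < n
    i′<n = at-<⇒< α (≤-<-trans z≤n a<b)
    e = gridSum var (swapV i α) (δ (topLabels 0 m α))
    swapped : swapP i (⟦ e ⟧ one) ≈P ⟦ gridSum (var ∘ swapN i) (swapV i α) (δ (topLabels 0 m α)) ⟧ one
    swapped γ = ≡.trans (swapP-⟦⟧ i e one i′<n γ) (≡.trans (⟦⟧-cong (rename (swapN i) e) (swapP-one i) γ)
      (cong (λ d → ⟦ d ⟧ one γ) (rename-gridSum (swapN i) var (swapV i α) (rename-δ (swapN i) (topLabels 0 m α)))))

  -- Swapping an ascent lowers `weight`, so `N` bounds the number of swaps still to come.
  labelSum-topLascoux : ∀ m (α : Vec ℕ n) N → weight α < N → Snowy α → (∀ i → at α i ≤ m) → IsTopLascoux α (labelSum m α)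
  labelSum-topLascoux m α (suc N) w<N s le with ascent α
  ... | inj₁ p = base p (λ γ → ≡.trans (S.gridSum-partition var α s p le one γ) (⟦monomial⟧ α γ))
  ... | inj₂ (i , a<b) = step i (labelSum m (swapV i α)) h a<b
      (labelSum-topLascoux m (swapV i α) N (<-≤-trans (weight-swapV i α a<b) (s≤s⁻¹ w<N)) (snowy-swapV i α i′<n s)
        (λ j → subst (_≤ m) (sym (at-swapV i j α i′<n)) (le (swapN i j))))
      isDivDiff f≈h
    where
    i′<n : suc i < n
    i′<n = at-<⇒< α (≤-<-trans z≤n a<b)
    open Divide i i′<n (labelSum m α) (labelSum m (swapV i α)) (labelSum-exch m α i a<b)

-- Passage to an arbitrary enumeration of the pipe dreams.

isTopLascoux-resp : ∀ {n} {α : Vec ℕ n} {f f′} → f ≈P f′ → IsTopLascoux α f′ → IsTopLascoux α f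
isTopLascoux-resp e (base p e′)          = base p (λ γ → ≡.trans (e γ) (e′ γ))
isTopLascoux-resp e (step i g h lt t d e′) = step i g h lt t d (λ γ → ≡.trans (e γ) (e′ γ))

sumMonos-↭ : ∀ {A : Set} {n} (wt : A → Vec ℕ n) {as bs} → as ↭ bs → sumMonos (map wt as) ≈P sumMonos (map wt bs)
sumMonos-↭ wt refl            γ = refl
sumMonos-↭ wt (prep a p)      γ = cong (monoP (wt a) γ +ℤ_) (sumMonos-↭ wt p γ)
sumMonos-↭ wt (swap a b p) γ =
  ≡.trans (cong (λ z → monoP (wt a) γ +ℤ (monoP (wt b) γ +ℤ z)) (sumMonos-↭ wt p γ))
    (≡.trans (sym (ℤₚ.+-assoc (monoP (wt a) γ) _ _))
      (≡.trans (cong (_+ℤ _) (ℤₚ.+-comm (monoP (wt a) γ) (monoP (wt b) γ)))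
        (ℤₚ.+-assoc (monoP (wt b) γ) _ _)))
sumMonos-↭ wt (trans p q)     γ = ≡.trans (sumMonos-↭ wt p γ) (sumMonos-↭ wt q γ)

at-≤-maxV : ∀ {n} (α : Vec ℕ n) i → at α i ≤ maxV α
at-≤-maxV []      i       = z≤n
at-≤-maxV (a ∷ α) zero    = m≤m⊔n a _
at-≤-maxV (a ∷ α) (suc i) = ≤-trans (at-≤-maxV α i) (m≤n⊔m a _)

theorem5p6 : ∀ {n} (α : Vec ℕ n) → Trimmed α → Snowy α →
    (Ds : List (Grid n (maxV α))) → Unique Ds →
    (∀ D → (D ∈ Ds) ⇔ IsLTBPD α D) →
    IsTopLascoux α (sumMonos (map wtNB Ds))
theorem5p6 {n} α _ snowy Ds unique char =
  isTopLascoux-resp (λ γ → ≡.trans (sumMonos-↭ wtNB Ds↭ γ) (sym (labelSum-sumMonos m α γ)))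
    (labelSum-topLascoux m α (suc (weight α)) ≤-refl snowy (at-≤-maxV α))
  where
  m = maxV α
  Ds↭ : Ds ↭ pipeDreams m α
  -- Two lists without repetitions and with the same elements are permutations of each other.
  Ds↭ = ∼bag⇒↭ (unique∧set⇒bag unique (filter⁺ (runs? α) (grids-unique n m)) (λ {D} → mk⇔
    (λ D∈ → ∈-filter⁺ (runs? α) (grids-complete D) (lab⇒run (bpd⇒lab snowy (Equivalence.to (char D) D∈))))
    (λ D∈ → Equivalence.from (char D)
      (lab⇒bpd snowy (run⇒lab α D (proj₂ (∈-filter⁻ (runs? α) {xs = grids n m} D∈)))))))
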